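{- Let $p$ be an odd prime, let $A$ be a set in $\mathbb{F}_p$ and let $d\ge 3$ be odd. (i) If $d=3$ and $|A|\le p^{4/7}$, then $f_3(A)\gg |A|^{7/4}$. (ii) If $d\ge 5$ is odd and $|A|\le p^{\frac{45 \times 2^{(d-1)/2}}{136 \times 2^{(d-1)/2}-137}}$, then \[f_d(A)\gtrsim |A|^{\frac{5}{2}+\frac{1}{90}-\frac{137}{45\times 2^{(d+1)/2}}}.\]
   Context: For a positive integer $d$, $M_d(A)$ denotes the set of $d\times d$ matrices all of whose entries lie in $A$, and $f_d(A)$ denotes the number of distinct values $\mathrm{Det}(M)$ for $M\in M_d(A)$ (determinants computed in $\mathbb{F}_p$). The notation $U\ll V$ (equivalently $V\gg U$) means $|U|\le cV$ for some constant $c>0$; $U\gtrsim V$ means $U\gg (\log U)^{ -c}V$ for some positive constant $c$. Implied constants may depend on $d$ but not on $p$ or $A$. -}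

module Defs where

open import Data.Nat as ℕ using (ℕ; zero; suc; NonZero)
open import Data.Nat.Properties as ℕP using ()
open import Data.Integer as ℤ using (ℤ; +_; _%ℕ_)
open import Data.Fin using (Fin; zero; suc; toℕ; punchIn)
open import Data.Fin.Subset using (Subset; _∈_)
open import Data.Fin.Subset.Properties using (_∈?_)
open import Data.List as List using (List; []; _∷_; map; concatMap; allFin; filter; length; deduplicate)
open import Data.Vec using (Vec; []; _∷_; lookup)

sumFin : (n : ℕ) → (Fin n → ℤ) → ℤ
sumFin zero    f = + 0
sumFin (suc n) f = f zero ℤ.+ sumFin n (λ i → f (suc i))

sign : {n : ℕ} → Fin n → ℤ
sign zero    = + 1
sign (suc j) = ℤ.- sign j

det : (n : ℕ) → (Fin n → Fin n → ℤ) → ℤ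
det zero    M = + 1
det (suc n) M =
  sumFin (suc n) (λ j → sign j ℤ.* (M zero j ℤ.* det n (λ i k → M (suc i) (punchIn j k))))

Mat : ℕ → ℕ → Set
Mat p d = Vec (Vec (Fin p) d) d

-- determinant computed in F_p, returned as its representative in {0,…,p-1}
detFp : (p : ℕ) .{{_ : NonZero p}} (d : ℕ) → Mat p d → ℕ
detFp p d M = det d (λ i j → + toℕ (lookup (lookup M i) j)) %ℕ p

allVecs : {X : Set} (n : ℕ) → List X → List (Vec X n)
allVecs zero    xs = [] ∷ []
allVecs (suc n) xs = concatMap (λ x → map (x ∷_) (allVecs n xs)) xs

elems : {p : ℕ} → Subset p → List (Fin p)
elems {p} A = filter (_∈? A) (allFin p)

matricesOver : {p : ℕ} (d : ℕ) → Subset p → List (Mat p d)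
matricesOver d A = allVecs d (allVecs d (elems A))

f : (d p : ℕ) .{{_ : NonZero p}} → Subset p → ℕ
f d p A = length (deduplicate ℕ._≟_ (map (detFp p d) (matricesOver d A)))

{-# OPTIONS --safe #-}
-- Both bounds follow from stronger ones: f₃ ≫ min (N², p), and f_d ≫ min (N³, p) for d ≥ 5, where N = |A|.
-- By a polynomial method in the style of Rédei and Szőnyi, a product set as × bs with at most p points
-- determines at least about |as × bs| - |bs| slopes. Averaging over them, for one of these slopes
-- ξ = (b - b′)/(a - a′) the lines of slope ξ through as × bs number at least |as × bs|/4, so
-- (a - a′) y - (b - b′) x takes that many values. With as = bs = A these are, up to an affine
-- map, 3 × 3 determinants; repeating the step with bs the set of values just found gives 5 × 5 determinants.
-- Larger determinants take at least as many values, by adding a row and a column.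
module Submission where

-- The slope count rests on a degenerate direction. If slope ξ separates the n points, their
-- intercepts are distinct modulo p, so Fermat turns the divided difference of x^(i+p) into that of
-- x^(i+1), which is 0 for i + 3 ≤ n. As a polynomial in ξ it has degree at most i + p + 1 - n, so
-- if few slopes are determined it has enough roots to vanish modulo p for every ξ, also for ξ = 0.
-- There the intercepts are the elements of `bs`, each repeated once per element of `as`; hence
-- divided differences are taken as complete homogeneous polynomials, which make sense at repeated
-- nodes. Removing nodes, and using that the derivative of x^p is 0 modulo p, then forces `bs` into
-- one residue class. Truncating the second factor keeps the product within p points, which is the
-- source of p in the two minima. For the exponents put x = 2^k with k = (d - 1)/2 ≥ 2: the target
-- N^((226x - 137)/(90x)) is below N³, and it is at most p by the hypothesis on N, because 137 ≤
-- 46x. No logarithm is lost.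

module Determinants where

  open import Defs
  open import Data.Bool using (true; false)
  open import Data.Empty using (⊥)
  open import Data.Fin using (Fin; zero; suc; toℕ; punchIn)
  open import Data.Fin.Properties using (toℕ<n; toℕ-injective)
  open import Data.Fin.Subset using (Subset; inside; outside; ∣_∣) renaming (_∈_ to _∈ₛ_)
  open import Data.Fin.Subset.Properties using (_∈?_; drop-there)
  open import Data.Integer as ℤ using (ℤ; +_; -[1+_]; _+_; _*_; _-_; -_; _^_; _%ℕ_; _/ℕ_)
  open import Data.Integer.Divisibility.Signed
    using (_∣_; divides; ∣⇒∣ᵤ; ∣ᵤ⇒∣; ∣m∣n⇒∣m+n; ∣m∣n⇒∣m-n; ∣n⇒∣m*n; ∣m⇒∣m*n; ∣m⇒∣-m; _∣?_)
  open import Data.Integer.DivMod using (a≡a%ℕn+[a/ℕn]*n)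
  import Data.Integer.Properties as ℤP
  open import Data.Integer.Solver using (module +-*-Solver)
  open +-*-Solver using (Polynomial; solve; con; _:=_; _:+_; _:*_; _:-_; :-_)
  open import Data.Integer.Tactic.RingSolver using (solve-∀)
  open import Data.List
    using (List; []; _∷_; _++_; length; map; foldr; filter; upTo; cartesianProduct; take; tabulate; deduplicate)
  open import Data.List.Membership.Propositional using (_∈_; find; lose)
  open import Data.List.Membership.Propositional.Properties
    using (∈-cartesianProduct⁻; ∈-filter⁻; ∈-length; ∈-map⁺; ∈-map⁻; ∈-concatMap⁺; ∈-deduplicate⁺;
           ∈-∃++; ∈-++⁻; ∈-++⁺ˡ; ∈-++⁺ʳ)
  open import Data.List.Properties
    using (length-map; length-++; length-upTo; length-take; map-++; map-∘; map-id; map-cong)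
  open import Data.List.Relation.Unary.All as All using (All; []; _∷_)
  import Data.List.Relation.Unary.All.Properties as AllP
  open import Data.List.Relation.Unary.AllPairs as AllPairs using (AllPairs; []; _∷_)
  import Data.List.Relation.Unary.AllPairs.Properties as AllPairsP
  open import Data.List.Relation.Unary.Any using (Any; here; there; any?)
  import Data.List.Relation.Unary.Unique.Propositional.Properties as UniqueP
  open import Data.Nat as ℕ using (ℕ; zero; suc; z≤n; s≤s; NonZero)
  open import Data.Nat.Combinatorics using (_C_; nCk+nC[k+1]≡[n+1]C[k+1]; nCn≡1; nC1≡n; k>n⇒nCk≡0)
  import Data.Nat.Divisibility as ℕD
  open import Data.Nat.DivMod using (m/n*n≤m; m≡m%n+[m/n]*n; m%n<n; /-mono-≤; m*n/n≡m)
  open import Data.Nat.ListAction using (sum)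
  open import Data.Nat.Primality using (Prime; euclidsLemma; prime⇒nonZero)
  import Data.Nat.Properties as ℕP
  open import Data.Nat.Tactic.RingSolver using () renaming (solve-∀ to ℕsolve-∀)
  open import Data.Product using (_×_; _,_; ∃-syntax; proj₁; proj₂)
  open import Data.Sum using (_⊎_; inj₁; inj₂)
  open import Data.Vec as Vec using (Vec; []; _∷_; lookup)
  open import Data.Vec.Properties using (lookup∘tabulate)
  import Data.Vec.Relation.Unary.All as VecAll
  open VecAll using ([]; _∷_)
  open import Data.Vec.Relation.Unary.All.Properties using (lookup⁺)
  open import Function using (_∘_; id)
  open import Relation.Binary using (tri<; tri≈; tri>)
  open import Relation.Binary.PropositionalEquality
  open import Relation.Nullary using (¬_; Dec; yes; no; does; contradiction)
  open import Relation.Unary using (Decidable)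
  open import Relation.Unary.Properties using (∁?)

  -- Divided differences of the monomial x^E.

  -- DD E (y₁ ∷ … ∷ yₙ ∷ []) is the complete homogeneous symmetric polynomial of
  -- degree E + 1 - n, and 0 when that degree is negative.
  DD : ℕ → List ℤ → ℤ
  DD E       []          = + 0
  DD zero    (y ∷ [])    = + 1
  DD zero    (y ∷ z ∷ L) = + 0
  DD (suc E) (y ∷ L)     = DD E L + y * DD E (y ∷ L)

  DD-low : ∀ E L → suc (suc E) ℕ.≤ length L → DD E L ≡ + 0
  DD-low zero    (y ∷ z ∷ L) _ = refl
  DD-low zero    (y ∷ [])    (s≤s ())
  DD-low (suc E) (y ∷ L)     (s≤s h) = trans
    (cong₂ (λ u v → u + y * v) (DD-low E L h) (DD-low E (y ∷ L) (ℕP.m≤n⇒m≤1+n h)))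
    (cong (_+_ (+ 0)) (ℤP.*-zeroʳ y))

  -- The classical difference quotient with its denominator cleared, so coinciding nodes are
  -- allowed. Modulo p it can be divided out again whenever y and z are incongruent.
  DD-diff : ∀ E y z L → (y - z) * DD E (y ∷ z ∷ L) ≡ DD E (y ∷ L) - DD E (z ∷ L)
  DD-diff zero y z []      = ℤP.*-zeroʳ (y - z)
  DD-diff zero y z (w ∷ L) = ℤP.*-zeroʳ (y - z)
  DD-diff (suc E) y z L = trans
    (split y z (DD E (z ∷ L)) (DD E (y ∷ z ∷ L)))
    (trans (cong (λ t → (y - z) * DD E (z ∷ L) + y * t) (DD-diff E y z L))
           (regroup y z (DD E L) (DD E (y ∷ L)) (DD E (z ∷ L))))
    where
    split : ∀ y z a b → (y - z) * (a + y * b) ≡ (y - z) * a + y * ((y - z) * b)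
    split = solve-∀
    regroup : ∀ y z l a b → (y - z) * b + y * (a - b) ≡ l + y * a - (l + z * b)
    regroup = solve-∀

  -- The recursion singles out the head, so symmetry is not visible in it; `DD-diff` supplies the
  -- exchange that later allows nodes to be discarded from any position.
  DD-swap : ∀ E y z L → DD E (y ∷ z ∷ L) ≡ DD E (z ∷ y ∷ L)
  DD-swap zero    y z L = refl
  DD-swap (suc E) y z L = trans
    (rearrange y z (DD E (z ∷ L)) (DD E (y ∷ z ∷ L)))
    (cong₂ (λ u v → u + z * v)
      (trans (cong (_+_ (DD E (z ∷ L))) (DD-diff E y z L)) (cancel (DD E (z ∷ L)) (DD E (y ∷ L))))
      (DD-swap E y z L))
    where
    rearrange : ∀ y z a b → a + y * b ≡ (a + (y - z) * b) + z * b
    rearrange = solve-∀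
    cancel : ∀ a b → a + (b - a) ≡ b
    cancel = solve-∀

  sumℤ : List ℤ → ℤ
  sumℤ = foldr _+_ (+ 0)

  -- Differentiating a divided difference in one node doubles that node. So for `zs` equal to `Y`
  -- this is the derivative under simultaneous translation of all nodes; the two lists are kept
  -- separate for the induction.
  sumDD : ℕ → List ℤ → List ℤ → ℤ
  sumDD E zs Y = sumℤ (map (λ z → DD E (z ∷ Y)) zs)

  sumDD-step : ∀ E y zs L → sumDD (suc E) zs (y ∷ L) ≡ sumDD E zs L + y * sumDD E zs (y ∷ L)
  sumDD-step E y []       L = sym (cong (_+_ (+ 0)) (ℤP.*-zeroʳ y))
  sumDD-step E y (z ∷ zs) L = trans
    (cong₂ _+_ (DD-swap (suc E) z y L) (sumDD-step E y zs L))
    (trans (cong (λ t → (DD E (z ∷ L) + y * t) + (sumDD E zs L + y * sumDD E zs (y ∷ L))) (DD-swap E y z L))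
           (regroup y (DD E (z ∷ L)) (DD E (z ∷ y ∷ L)) (sumDD E zs L) (sumDD E zs (y ∷ L))))
    where
    regroup : ∀ y a b c d → (a + y * b) + (c + y * d) ≡ (a + c) + y * (b + d)
    regroup = solve-∀

  sumDD-zero : ∀ zs y L → sumDD 0 zs (y ∷ L) ≡ + 0
  sumDD-zero []       y L = refl
  sumDD-zero (z ∷ zs) y L = trans (ℤP.+-identityˡ _) (sumDD-zero zs y L)

  -- The derivative of a divided difference is the divided difference of the derivative.
  DD-derivative : ∀ E Y → sumDD (suc E) Y Y ≡ + suc E * DD E Y
  DD-derivative E       []      = sym (ℤP.*-zeroʳ (+ suc E))
  DD-derivative zero    (y ∷ L) = trans
    (cong (_+_ (DD 0 (y ∷ L) + y * + 0))
      (trans (sumDD-step 0 y L L) (cong₂ (λ u v → u + y * v) (base L) (sumDD-zero L y L))))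
    (simp y (DD 0 (y ∷ L)))
    where
    base : ∀ L → sumDD 0 L L ≡ + 0
    base []      = refl
    base (y ∷ L) = sumDD-zero (y ∷ L) y L
    simp : ∀ y a → a + y * + 0 + (+ 0 + y * + 0) ≡ + 1 * a
    simp = solve-∀
  DD-derivative (suc E) (y ∷ L) = trans
    (cong (_+_ (DD (suc (suc E)) (y ∷ y ∷ L))) (sumDD-step (suc E) y L L))
    (trans (regroup y (DD (suc E) (y ∷ L)) (DD (suc E) (y ∷ y ∷ L)) (sumDD (suc E) L L) (sumDD (suc E) L (y ∷ L)))
    (trans (cong₂ (λ u v → DD (suc E) (y ∷ L) + (u + y * v)) (DD-derivative E L) (DD-derivative E (y ∷ L)))
           (collect y (+ suc E) (DD E L) (DD E (y ∷ L)))))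
    where
    regroup : ∀ y a b c d → (a + y * b) + (c + y * d) ≡ a + (c + y * (b + d))
    regroup = solve-∀
    collect : ∀ y e a b → (a + y * b) + (e * a + y * (e * b)) ≡ (+ 1 + e) * (a + y * b)
    collect = solve-∀

  -- Polynomial functions and their degree in the slope.

  -- Poly j g: g is a polynomial function of degree less than j, expressed by
  -- repeated division by x - r.
  Poly : ℕ → (ℤ → ℤ) → Set
  Poly zero    g = ∀ x → g x ≡ + 0
  Poly (suc j) g = ∀ r → ∃[ q ] Poly j q × (∀ x → g x ≡ g r + (x - r) * q x)

  poly-const : ∀ j c → Poly (suc j) (λ _ → c)
  poly-0     : ∀ j → Poly j (λ _ → + 0)
  poly-const j c r = (λ _ → + 0) , poly-0 j , λ x → sym (trans (cong (_+_ c) (ℤP.*-zeroʳ (x - r))) (ℤP.+-identityʳ c))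
  poly-0 zero    = λ _ → refl
  poly-0 (suc j) = poly-const j (+ 0)

  poly-≗ : ∀ j {g h} → (∀ x → g x ≡ h x) → Poly j g → Poly j h
  poly-≗ zero    e P x = trans (sym (e x)) (P x)
  poly-≗ (suc j) e P r with P r
  ... | q , Q , eq = q , Q , λ x → trans (sym (e x)) (trans (eq x) (cong (_+ (x - r) * q x) (e r)))

  poly-+ : ∀ j {g h} → Poly j g → Poly j h → Poly j (λ x → g x + h x)
  poly-+ zero    P P′ x = cong₂ _+_ (P x) (P′ x)
  poly-+ (suc j) {g} {h} P P′ r with P r | P′ r
  ... | q , Q , eq | q′ , Q′ , eq′ =
    (λ x → q x + q′ x) , poly-+ j Q Q′ ,
    λ x → trans (cong₂ _+_ (eq x) (eq′ x)) (regroup (g r) (h r) (x - r) (q x) (q′ x))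
    where
    regroup : ∀ a b d u v → (a + d * u) + (b + d * v) ≡ (a + b) + d * (u + v)
    regroup = solve-∀

  poly-linear-* : ∀ j u v {g} → Poly j g → Poly (suc j) (λ x → (u - x * v) * g x)
  poly-linear-* zero u v {g} P = poly-≗ 1
    (λ x → sym (trans (cong ((u - x * v) *_) (P x)) (ℤP.*-zeroʳ (u - x * v)))) (poly-0 1)
  poly-linear-* (suc j) u v {g} P r with P r
  ... | q , Q , eq =
    (λ x → (u - x * v) * q x + (- v) * g r) ,
    poly-+ (suc j) (poly-linear-* j u v Q) (poly-const j _) ,
    λ x → trans (cong ((u - x * v) *_) (eq x)) (expand u v x r (g r) (q x))
    where
    expand : ∀ u v x r a b → (u - x * v) * (a + (x - r) * b)
           ≡ (u - r * v) * a + (x - r) * ((u - x * v) * b + (- v) * a)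
    expand = solve-∀

  Point : Set
  Point = ℤ × ℤ

  -- The position at which the line of slope ξ through the point meets the vertical axis.
  intercept : ℤ → Point → ℤ
  intercept ξ (a , b) = b - ξ * a

  -- Intercepts are linear in the slope, and `DD E` is homogeneous of degree E + 1 - length U in its
  -- nodes. Here j is that degree plus one, and j = 0 is the case of negative degree.
  DD-poly : ∀ j E U → j ℕ.+ length U ≡ suc (suc E) → Poly j (λ ξ → DD E (map (intercept ξ) U))
  DD-poly zero E U e ξ = DD-low E (map (intercept ξ) U)
    (ℕP.≤-reflexive (trans (sym e) (sym (length-map (intercept ξ) U))))
    where open import Data.List.Properties using (length-map)
  DD-poly (suc j) E       []          e = poly-0 (suc j)
  DD-poly (suc j) zero    (u ∷ [])    e = poly-const j (+ 1)
  DD-poly (suc j) zero    (u ∷ v ∷ U) e = poly-0 (suc j)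
  DD-poly (suc j) (suc E) ((a , b) ∷ U) e = poly-+ (suc j)
    (DD-poly (suc j) E U (ℕP.suc-injective (trans (sym (ℕP.+-suc (suc j) (length U))) e)))
    (poly-linear-* j b a (DD-poly j E ((a , b) ∷ U) (ℕP.suc-injective e)))

  -- Fermat's little theorem.

  C-absorption : ∀ n k → suc k ℕ.* (suc n C suc k) ≡ suc n ℕ.* (n C k)
  C-absorption n zero = trans (ℕP.+-identityʳ _) (trans (nC1≡n (suc n)) (sym (ℕP.*-identityʳ (suc n))))
  C-absorption zero (suc k) = trans
    (cong (suc (suc k) ℕ.*_) (k>n⇒nCk≡0 {1} {suc (suc k)} (s≤s (s≤s z≤n))))
    (ℕP.*-zeroʳ (suc (suc k)))
  C-absorption (suc n) (suc k) = begin
    suc (suc k) ℕ.* (suc (suc n) C suc (suc k))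
      ≡⟨ cong (suc (suc k) ℕ.*_) (nCk+nC[k+1]≡[n+1]C[k+1] (suc n) (suc k)) ⟨
    suc (suc k) ℕ.* (a ℕ.+ b)
      ≡⟨ ℕP.*-distribˡ-+ (suc (suc k)) a b ⟩
    a ℕ.+ suc k ℕ.* a ℕ.+ suc (suc k) ℕ.* b
      ≡⟨ ℕP.+-assoc a (suc k ℕ.* a) (suc (suc k) ℕ.* b) ⟩
    a ℕ.+ (suc k ℕ.* a ℕ.+ suc (suc k) ℕ.* b)
      ≡⟨ cong (a ℕ.+_) (cong₂ ℕ._+_ (C-absorption n k) (C-absorption n (suc k))) ⟩
    a ℕ.+ (suc n ℕ.* (n C k) ℕ.+ suc n ℕ.* (n C suc k))
      ≡⟨ cong (a ℕ.+_) (ℕP.*-distribˡ-+ (suc n) (n C k) (n C suc k)) ⟨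
    a ℕ.+ suc n ℕ.* (n C k ℕ.+ n C suc k)
      ≡⟨ cong (λ t → a ℕ.+ suc n ℕ.* t) (nCk+nC[k+1]≡[n+1]C[k+1] n k) ⟩
    suc (suc n) ℕ.* a ∎
    where
    open ≡-Reasoning
    a = suc n C suc k
    b = suc n C suc (suc k)

  -- Absorption shows that p divides k · C(p, k), and p cannot divide a positive k below it.
  prime∣C : ∀ {p k} → Prime p → 0 ℕ.< k → k ℕ.< p → p ℕD.∣ p C k
  prime∣C {suc q} {suc k} pr _ k<p
    with euclidsLemma (suc k) (suc q C suc k) pr
           (ℕD.divides (q C k) (trans (C-absorption q k) (ℕP.*-comm (suc q) (q C k))))
  ... | inj₁ h = contradiction (ℕP.<-≤-trans k<p (ℕD.∣⇒≤ h)) (ℕP.<-irrefl refl)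
  ... | inj₂ h = h

  binomialSum : ℕ → ℤ → ℕ → ℤ
  binomialSum n x zero    = + 0
  binomialSum n x (suc m) = binomialSum n x m + + (n C m) * x ^ m

  binomialSum-pascal : ∀ n x m →
    binomialSum (suc n) x (suc m) ≡ binomialSum n x (suc m) + x * binomialSum n x m
  binomialSum-pascal n x zero = sym (trans (cong (_+_ (+ 1)) (ℤP.*-zeroʳ x)) refl)
  binomialSum-pascal n x (suc m) = trans
    (cong₂ _+_ (binomialSum-pascal n x m)
      (cong (λ c → + c * x ^ suc m) (sym (nCk+nC[k+1]≡[n+1]C[k+1] n m))))
    (regroup (binomialSum n x (suc m)) (binomialSum n x m) x (x ^ m) (+ (n C m)) (+ (n C suc m)))
    where
    regroup : ∀ s t x y a b → (s + x * t) + (a + b) * (x * y) ≡ (s + b * (x * y)) + x * (t + a * y)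
    regroup = solve-∀

  binomial-theorem : ∀ n x → (+ 1 + x) ^ n ≡ binomialSum n x (suc n)
  binomial-theorem zero    x = refl
  binomial-theorem (suc n) x = sym (begin
    binomialSum (suc n) x (suc (suc n))
      ≡⟨ binomialSum-pascal n x (suc n) ⟩
    S + + (n C suc n) * x ^ suc n + x * S
      ≡⟨ cong (λ c → S + + c * x ^ suc n + x * S) (k>n⇒nCk≡0 {n} {suc n} ℕP.≤-refl) ⟩
    S + + 0 * x ^ suc n + x * S
      ≡⟨ factor S x (x ^ suc n) ⟩
    (+ 1 + x) * S
      ≡⟨ cong ((+ 1 + x) *_) (binomial-theorem n x) ⟨
    (+ 1 + x) ^ suc n ∎)
    where
    open ≡-Reasoning
    S = binomialSum n x (suc n)
    factor : ∀ s x y → s + + 0 * y + x * s ≡ (+ 1 + x) * s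
    factor = solve-∀

  DD-power : ∀ E y → DD E (y ∷ []) ≡ y ^ E
  DD-power zero    y = refl
  DD-power (suc E) y = trans (ℤP.+-identityˡ _) (cong (y *_) (DD-power E y))

  -- Counting pairs and sums, and the averaging inequality.

  triangle : ℕ → ℕ
  triangle zero    = 0
  triangle (suc n) = n ℕ.+ triangle n

  triangle-double : ∀ n → 2 ℕ.* triangle n ℕ.+ n ≡ n ℕ.* n
  triangle-double zero    = refl
  triangle-double (suc n) = trans (expand n (triangle n))
    (trans (cong (λ t → suc (2 ℕ.* n ℕ.+ t)) (triangle-double n)) (square n))
    where
    expand : ∀ n t → 2 ℕ.* (n ℕ.+ t) ℕ.+ suc n ≡ suc (2 ℕ.* n ℕ.+ (2 ℕ.* t ℕ.+ n))
    expand = ℕsolve-∀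
    square : ∀ n → suc (2 ℕ.* n ℕ.+ n ℕ.* n) ≡ suc n ℕ.* suc n
    square = ℕsolve-∀

  length-filter-∁ : ∀ {ℓ} {X : Set} {P : X → Set ℓ} (P? : Decidable P) xs →
    length (filter P? xs) ℕ.+ length (filter (∁? P?) xs) ≡ length xs
  length-filter-∁ P? [] = refl
  length-filter-∁ P? (x ∷ xs) with does (P? x)
  ... | true  = cong suc (length-filter-∁ P? xs)
  ... | false = trans (ℕP.+-suc _ _) (cong suc (length-filter-∁ P? xs))

  length-cartesianProduct : ∀ {X Y : Set} (xs : List X) (ys : List Y) →
    length (cartesianProduct xs ys) ≡ length xs ℕ.* length ys
  length-cartesianProduct []       ys = refl
  length-cartesianProduct (x ∷ xs) ys = trans (length-++ (map (x ,_) ys))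
    (cong₂ ℕ._+_ (length-map (x ,_) ys) (length-cartesianProduct xs ys))

  sum-map-+ : ∀ {X : Set} (g h : X → ℕ) xs →
    sum (map (λ x → g x ℕ.+ h x) xs) ≡ sum (map g xs) ℕ.+ sum (map h xs)
  sum-map-+ g h []       = refl
  sum-map-+ g h (x ∷ xs) = trans (cong (g x ℕ.+ h x ℕ.+_) (sum-map-+ g h xs))
    (regroup (g x) (h x) (sum (map g xs)) (sum (map h xs)))
    where
    regroup : ∀ a b c d → a ℕ.+ b ℕ.+ (c ℕ.+ d) ≡ a ℕ.+ c ℕ.+ (b ℕ.+ d)
    regroup = ℕsolve-∀

  sum-map-zero : ∀ {X : Set} (g : X → ℕ) {xs} → All (λ x → g x ≡ 0) xs → sum (map g xs) ≡ 0
  sum-map-zero g []       = refl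
  sum-map-zero g (e ∷ es) = cong₂ ℕ._+_ e (sum-map-zero g es)

  sum-map-≥ : ∀ {X : Set} (g : X → ℕ) k c {xs} → All (λ x → k ℕ.≤ c ℕ.* g x) xs →
    length xs ℕ.* k ℕ.≤ c ℕ.* sum (map g xs)
  sum-map-≥ g k c []               = z≤n
  sum-map-≥ g k c {x ∷ xs} (h ∷ hs) = ℕP.≤-trans (ℕP.+-mono-≤ h (sum-map-≥ g k c hs))
    (ℕP.≤-reflexive (sym (ℕP.*-distribˡ-+ c (g x) (sum (map g xs)))))

  -- Arithmetic of the averaging step: n points, m slopes, at most t collisions in total.
  averaging-absurd : ∀ {n m t} → 4 ℕ.≤ n → 3 ℕ.* n ℕ.≤ 4 ℕ.* suc m → 2 ℕ.* t ℕ.+ n ≡ n ℕ.* n →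
    m ℕ.* suc (3 ℕ.* n) ℕ.≤ 4 ℕ.* t → ⊥
  averaging-absurd {n} {m} {t} 4≤n slopes pairs average = ℕP.<-irrefl refl (begin-strict
    n ℕ.+ 3 ℕ.* n           ≡⟨⟩
    4 ℕ.* n                 ≤⟨ ℕP.*-monoˡ-≤ n 4≤n ⟩
    n ℕ.* n                 ≤⟨ ℕP.+-cancelˡ-≤ (8 ℕ.* (n ℕ.* n) ℕ.+ 11 ℕ.* n) _ _ squares ⟩
    n ℕ.+ 4                 <⟨ ℕP.+-monoʳ-< n (ℕP.<-≤-trans (ℕP.m≤m+n 5 7) (ℕP.*-monoʳ-≤ 3 4≤n)) ⟩
    n ℕ.+ 3 ℕ.* n           ∎)
    where
    open ℕP.≤-Reasoning
    expand₁ : ∀ n → 8 ℕ.* (n ℕ.* n) ℕ.+ 11 ℕ.* n ℕ.+ n ℕ.* n ≡ 3 ℕ.* n ℕ.* suc (3 ℕ.* n) ℕ.+ 8 ℕ.* n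
    expand₁ = ℕsolve-∀
    expand₂ : ∀ n m → 4 ℕ.* suc m ℕ.* suc (3 ℕ.* n) ℕ.+ 8 ℕ.* n
            ≡ 4 ℕ.* (m ℕ.* suc (3 ℕ.* n)) ℕ.+ (20 ℕ.* n ℕ.+ 4)
    expand₂ = ℕsolve-∀
    expand₃ : ∀ n t → 4 ℕ.* (4 ℕ.* t) ℕ.+ (20 ℕ.* n ℕ.+ 4) ≡ 8 ℕ.* (2 ℕ.* t ℕ.+ n) ℕ.+ (12 ℕ.* n ℕ.+ 4)
    expand₃ = ℕsolve-∀
    expand₄ : ∀ s n → 8 ℕ.* s ℕ.+ (12 ℕ.* n ℕ.+ 4) ≡ 8 ℕ.* s ℕ.+ 11 ℕ.* n ℕ.+ (n ℕ.+ 4)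
    expand₄ = ℕsolve-∀
    squares : 8 ℕ.* (n ℕ.* n) ℕ.+ 11 ℕ.* n ℕ.+ n ℕ.* n ℕ.≤ 8 ℕ.* (n ℕ.* n) ℕ.+ 11 ℕ.* n ℕ.+ (n ℕ.+ 4)
    squares = begin
      8 ℕ.* (n ℕ.* n) ℕ.+ 11 ℕ.* n ℕ.+ n ℕ.* n           ≡⟨ expand₁ n ⟩
      3 ℕ.* n ℕ.* suc (3 ℕ.* n) ℕ.+ 8 ℕ.* n              ≤⟨ ℕP.+-monoˡ-≤ _ (ℕP.*-monoˡ-≤ (suc (3 ℕ.* n)) slopes) ⟩
      4 ℕ.* suc m ℕ.* suc (3 ℕ.* n) ℕ.+ 8 ℕ.* n          ≡⟨ expand₂ n m ⟩
      4 ℕ.* (m ℕ.* suc (3 ℕ.* n)) ℕ.+ (20 ℕ.* n ℕ.+ 4)   ≤⟨ ℕP.+-monoˡ-≤ _ (ℕP.*-monoʳ-≤ 4 average) ⟩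
      4 ℕ.* (4 ℕ.* t) ℕ.+ (20 ℕ.* n ℕ.+ 4)               ≡⟨ expand₃ n t ⟩
      8 ℕ.* (2 ℕ.* t ℕ.+ n) ℕ.+ (12 ℕ.* n ℕ.+ 4)         ≡⟨ cong (λ s → 8 ℕ.* s ℕ.+ (12 ℕ.* n ℕ.+ 4)) pairs ⟩
      8 ℕ.* (n ℕ.* n) ℕ.+ (12 ℕ.* n ℕ.+ 4)               ≡⟨ expand₄ (n ℕ.* n) n ⟩
      8 ℕ.* (n ℕ.* n) ℕ.+ 11 ℕ.* n ℕ.+ (n ℕ.+ 4)         ∎

  unique-⊆⇒length≤ : ∀ {X : Set} {xs ys : List X} → AllPairs _≢_ xs → (∀ {x} → x ∈ xs → x ∈ ys) →
    length xs ℕ.≤ length ys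
  unique-⊆⇒length≤ []          _  = z≤n
  unique-⊆⇒length≤ {xs = x ∷ xs} (x# ∷ xs#) sub with ∈-∃++ (sub (here refl))
  ... | ys , zs , refl = ℕP.≤-trans
    (s≤s (unique-⊆⇒length≤ xs# λ y∈ → delete (∈-++⁻ ys (sub (there y∈))) (All.lookup x# y∈)))
    (ℕP.≤-reflexive (trans (cong suc (length-++ ys)) (trans (sym (ℕP.+-suc (length ys) (length zs))) (sym (length-++ ys)))))
    where
    delete : ∀ {y} → y ∈ ys ⊎ y ∈ (x ∷ zs) → x ≢ y → y ∈ ys ++ zs
    delete (inj₁ h)           _   = ∈-++⁺ˡ h
    delete (inj₂ (here refl)) x≢x = contradiction refl x≢x
    delete (inj₂ (there h))   _   = ∈-++⁺ʳ ys h

  ∣∣≡length-filter : ∀ {ℓ n} {X : Set} {P : X → Set ℓ} (P? : Decidable P) (A : Subset n) (g : Fin n → X) →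
    (∀ {i} → i ∈ₛ A → P (g i)) → (∀ {i} → P (g i) → i ∈ₛ A) → ∣ A ∣ ≡ length (filter P? (tabulate g))
  ∣∣≡length-filter P? []            g h k = refl
  ∣∣≡length-filter P? (inside ∷ A)  g h k with P? (g zero)
  ... | yes _ = cong suc (∣∣≡length-filter P? A (g ∘ suc) (h ∘ Vec.there) (drop-there ∘ k))
  ... | no ¬h = contradiction (h Vec.here) ¬h
  ∣∣≡length-filter P? (outside ∷ A) g h k with P? (g zero)
  ... | yes y = contradiction (k y) λ ()
  ... | no  _ = ∣∣≡length-filter P? A (g ∘ suc) (h ∘ Vec.there) (drop-there ∘ k)

  ∈-allVecs : ∀ {X : Set} {xs : List X} {n} (v : Vec X n) → (∀ i → lookup v i ∈ xs) → v ∈ allVecs n xs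
  ∈-allVecs []      _ = here refl
  ∈-allVecs {xs = xs} {suc n} (x ∷ v) h =
    ∈-concatMap⁺ (λ x → map (x ∷_) (allVecs n xs)) (lose (h zero) (∈-map⁺ (x ∷_) (∈-allVecs v (h ∘ suc))))

  -- Determinant identities.

  sumFin-cong : ∀ n {g h : Fin n → ℤ} → (∀ i → g i ≡ h i) → sumFin n g ≡ sumFin n h
  sumFin-cong zero    e = refl
  sumFin-cong (suc n) e = cong₂ _+_ (e zero) (sumFin-cong n (e ∘ suc))

  sumFin-zero : ∀ n {g : Fin n → ℤ} → (∀ i → g i ≡ + 0) → sumFin n g ≡ + 0
  sumFin-zero zero    e = refl
  sumFin-zero (suc n) e = cong₂ _+_ (e zero) (sumFin-zero n (e ∘ suc))

  det-cong : ∀ n {M N : Fin n → Fin n → ℤ} → (∀ i j → M i j ≡ N i j) → det n M ≡ det n N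
  det-cong zero    e = refl
  det-cong (suc n) e = sumFin-cong (suc n) λ j →
    cong (sign j *_) (cong₂ _*_ (e zero j) (det-cong n λ i k → e (suc i) (punchIn j k)))

  zero-term : ∀ s m {d} → d ≡ + 0 → s * (m * d) ≡ + 0
  zero-term s m refl = trans (cong (s *_) (ℤP.*-zeroʳ m)) (ℤP.*-zeroʳ s)

  -- In the expansion along the first row the first two terms have equal minors and opposite signs;
  -- all later minors still begin with two equal columns, so induction applies to them.
  det-equal-columns : ∀ n (M : Fin (suc (suc n)) → Fin (suc (suc n)) → ℤ) →
    (∀ i → M i zero ≡ M i (suc zero)) → det (suc (suc n)) M ≡ + 0
  det-equal-columns n M e = trans
    (cong₂ (λ m r → + 1 * (m * minor zero) + (- + 1 * (M zero (suc zero) * minor (suc zero)) + r)) (e zero) (rest n M e))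
    (trans (cong (λ d → + 1 * (M zero (suc zero) * d) + (- + 1 * (M zero (suc zero) * minor (suc zero)) + + 0)) same-minor)
           (cancel (M zero (suc zero)) (minor (suc zero))))
    where
    minor : Fin (suc (suc n)) → ℤ
    minor j = det (suc n) (λ i k → M (suc i) (punchIn j k))
    same-minor : minor zero ≡ minor (suc zero)
    same-minor = det-cong (suc n) {λ i k → M (suc i) (suc k)} {λ i k → M (suc i) (punchIn (suc zero) k)} λ where
      i zero    → sym (e (suc i))
      i (suc k) → refl
    cancel : ∀ m d → + 1 * (m * d) + (- + 1 * (m * d) + + 0) ≡ + 0
    cancel = solve-∀
    rest : ∀ n (M : Fin (suc (suc n)) → Fin (suc (suc n)) → ℤ) → (∀ i → M i zero ≡ M i (suc zero)) →
      sumFin n (λ j → sign (suc (suc j)) * (M zero (suc (suc j)) *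
        det (suc n) (λ i k → M (suc i) (punchIn (suc (suc j)) k)))) ≡ + 0
    rest zero    M e = refl
    rest (suc n) M e = sumFin-zero (suc n) λ j → zero-term (sign (suc (suc j))) (M zero (suc (suc j)))
      (det-equal-columns n (λ i k → M (suc i) (punchIn (suc (suc j)) k)) (e ∘ suc))

  -- The top row is a, b, ..., b, and below a the first column of `M` is repeated. Thus the first
  -- two columns differ only at the top, and no entry is introduced besides a, b and those of `M`.
  border : ∀ {n} → ℤ → ℤ → (Fin (suc n) → Fin (suc n) → ℤ) → Fin (suc (suc n)) → Fin (suc (suc n)) → ℤ
  border a b M zero    zero    = a
  border a b M zero    (suc j) = b
  border a b M (suc i) zero    = M i zero
  border a b M (suc i) (suc j) = M i j

  -- The first two minors both equal `M`, and every later one has equal first columns.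
  det-border : ∀ n a b (M : Fin (suc n) → Fin (suc n) → ℤ) →
    det (suc (suc n)) (border a b M) ≡ (a - b) * det (suc n) M
  det-border n a b M = trans
    (cong₂ (λ d r → + 1 * (a * det (suc n) M) + (- + 1 * (b * d) + r)) second-minor (rest n M))
    (collect a b (det (suc n) M))
    where
    second-minor : det (suc n) (λ i k → border a b M (suc i) (punchIn (suc zero) k)) ≡ det (suc n) M
    second-minor = det-cong (suc n) {λ i k → border a b M (suc i) (punchIn (suc zero) k)} {M} λ where
      i zero    → refl
      i (suc k) → refl
    collect : ∀ a b d → + 1 * (a * d) + (- + 1 * (b * d) + + 0) ≡ (a - b) * d
    collect = solve-∀
    rest : ∀ n (M : Fin (suc n) → Fin (suc n) → ℤ) →
      sumFin n (λ j → sign (suc (suc j)) * (b * det (suc n)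
        (λ i k → border a b M (suc i) (punchIn (suc (suc j)) k)))) ≡ + 0
    rest zero    M = refl
    rest (suc n) M = sumFin-zero (suc n) λ j → zero-term (sign (suc (suc j))) b
      (det-equal-columns n (λ i k → border a b M (suc i) (punchIn (suc (suc j)) k)) λ i → refl)

  -- sumFin, sign and det at the level of ring-solver expressions.
  sumP : ∀ {m} n → (Fin n → Polynomial m) → Polynomial m
  sumP zero    f = con (+ 0)
  sumP (suc n) f = f zero :+ sumP n (λ i → f (suc i))

  signP : ∀ {m n} → Fin n → Polynomial m
  signP zero    = con (+ 1)
  signP (suc j) = :- signP j

  detP : ∀ {m} n → (Fin n → Fin n → Polynomial m) → Polynomial m
  detP zero    M = con (+ 1)
  detP (suc n) M = sumP (suc n) (λ j → signP j :* (M zero j :* detP n (λ i k → M (suc i) (punchIn j k))))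

  entry : ∀ {X : Set} {n} → Vec (Vec X n) n → Fin n → Fin n → X
  entry M i j = lookup (lookup M i) j

  -- With a constant last column the determinant is, up to sign, e times twice the area of the
  -- triangle (x, y), (a, b), (a′, b′). It is affine in (x, y), and its linear part depends only on
  -- a - a′ and b - b′.
  mat3 : ∀ {X : Set} (x y e a a′ b b′ : X) → Vec (Vec X 3) 3
  mat3 x y e a a′ b b′ =
    (x ∷ y ∷ e ∷ []) ∷ (a ∷ b ∷ e ∷ []) ∷ (a′ ∷ b′ ∷ e ∷ []) ∷ []

  det-mat3 : ∀ x y e a a′ b b′ → det 3 (entry (mat3 x y e a a′ b b′))
    ≡ e * ((b - b′) * x - (a - a′) * y) + e * (a * b′ - a′ * b)
  det-mat3 = solve 7 (λ x y e a a′ b b′ → detP 3 (entry (mat3 x y e a a′ b b′))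
    := e :* ((b :- b′) :* x :- (a :- a′) :* y) :+ e :* (a :* b′ :- a′ :* b)) refl

  -- Subtracting the third column from the first two and the fifth from the fourth clears the last
  -- two rows there. What remains is a 3 by 3 determinant of differences and the 2 by 2 block with
  -- rows e, e and e, g. In the former, (a - a′, b - b′) is paired both with (x, y) and with (s -
  -- s′, t - t′).
  mat5 : ∀ {X : Set} (x y z e g a a′ b b′ s s′ t t′ q q′ : X) → Vec (Vec X 5) 5
  mat5 x y z e g a a′ b b′ s s′ t t′ q q′ =
    (x ∷ a ∷ a′ ∷ s ∷ s′ ∷ []) ∷
    (y ∷ b ∷ b′ ∷ t ∷ t′ ∷ []) ∷
    (z ∷ e ∷ e  ∷ q ∷ q′ ∷ []) ∷
    (e ∷ e ∷ e  ∷ e ∷ e  ∷ []) ∷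
    (e ∷ e ∷ e  ∷ g ∷ g  ∷ []) ∷ []

  det-mat5 : ∀ x y z e g a a′ b b′ s s′ t t′ q q′ →
    det 5 (entry (mat5 x y z e g a a′ b b′ s s′ t t′ q q′))
    ≡ e * (e - g) * ((x - a′) * ((b - b′) * (q - q′)) - (y - b′) * ((a - a′) * (q - q′))
                     + (z - e) * ((a - a′) * (t - t′) - (b - b′) * (s - s′)))
  det-mat5 = solve 15 (λ x y z e g a a′ b b′ s s′ t t′ q q′ →
    detP 5 (entry (mat5 x y z e g a a′ b b′ s s′ t t′ q q′))
    := e :* (e :- g) :* ((x :- a′) :* ((b :- b′) :* (q :- q′)) :- (y :- b′) :* ((a :- a′) :* (q :- q′))
                         :+ (z :- e) :* ((a :- a′) :* (t :- t′) :- (b :- b′) :* (s :- s′)))) refl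

  -- Numerical inequalities for the truncation and for the exponents.

  -- Shrinking a list of M elements so that its product with a list of N elements has at most P elements.
  budget : ∀ {N P} .{{_ : NonZero N}} M → 2 ℕ.* N ℕ.≤ P →
    ∃[ β ] β ℕ.≤ M × N ℕ.* β ℕ.≤ P × (β ≡ M ⊎ (2 ℕ.≤ β × P ℕ.≤ 2 ℕ.* (N ℕ.* β)))
  budget {N} {P} M 2N≤P with ℕP.≤-total M (P ℕ./ N)
  ... | inj₁ M≤ = M , ℕP.≤-refl ,
    ℕP.≤-trans (ℕP.*-monoʳ-≤ N M≤) (ℕP.≤-trans (ℕP.≤-reflexive (ℕP.*-comm N _)) (m/n*n≤m P N)) , inj₁ refl
  ... | inj₂ ≤M = q , ≤M , ℕP.≤-trans (ℕP.≤-reflexive (ℕP.*-comm N q)) (m/n*n≤m P N) , inj₂ (2≤q , P≤)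
    where
    q = P ℕ./ N
    2≤q : 2 ℕ.≤ q
    2≤q = subst (ℕ._≤ q) (m*n/n≡m 2 N) (/-mono-≤ {o = N} 2N≤P ℕP.≤-refl)
    P≤ : P ℕ.≤ 2 ℕ.* (N ℕ.* q)
    P≤ = begin
      P                         ≡⟨ m≡m%n+[m/n]*n P N ⟩
      P ℕ.% N ℕ.+ q ℕ.* N       ≤⟨ ℕP.+-monoˡ-≤ _ (ℕP.<⇒≤ (m%n<n P N)) ⟩
      N ℕ.+ q ℕ.* N             ≤⟨ ℕP.+-monoˡ-≤ _ (ℕP.m≤n*m N q {{ℕ.>-nonZero (ℕP.<⇒≤ 2≤q)}}) ⟩
      q ℕ.* N ℕ.+ q ℕ.* N       ≡⟨ double q N ⟩
      2 ℕ.* (N ℕ.* q)           ∎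
      where
      open ℕP.≤-Reasoning
      double : ∀ q N → q ℕ.* N ℕ.+ q ℕ.* N ≡ 2 ℕ.* (N ℕ.* q)
      double = ℕsolve-∀

  ^-distribʳ-* : ∀ k m n → (m ℕ.* n) ℕ.^ k ≡ m ℕ.^ k ℕ.* n ℕ.^ k
  ^-distribʳ-* zero    m n = refl
  ^-distribʳ-* (suc k) m n = trans (cong (m ℕ.* n ℕ.*_) (^-distribʳ-* k m n)) (swap m n (m ℕ.^ k) (n ℕ.^ k))
    where
    swap : ∀ m n a b → m ℕ.* n ℕ.* (a ℕ.* b) ≡ m ℕ.* a ℕ.* (n ℕ.* b)
    swap = ℕsolve-∀

  ^-mono-*-≤ : ∀ k {m} c n → m ℕ.≤ c ℕ.* n → m ℕ.^ k ℕ.≤ c ℕ.^ k ℕ.* n ℕ.^ k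
  ^-mono-*-≤ k c n h = ℕP.≤-trans (ℕP.^-monoˡ-≤ k h) (ℕP.≤-reflexive (^-distribʳ-* k c n))

  -- Otherwise N^7 ≤ 16 N^4, against N ≥ 4. The conclusion leaves room for two elements in a
  -- truncated second factor.
  seventh-fourth-power⇒2*≤ : ∀ {N P} → 4 ℕ.≤ N → N ℕ.^ 7 ℕ.≤ P ℕ.^ 4 → 2 ℕ.* N ℕ.≤ P
  seventh-fourth-power⇒2*≤ {N} {P} 4≤N h = ℕP.≮⇒≥ λ P<2N → ℕP.<-irrefl refl (begin-strict
    16 ℕ.* N ℕ.^ 4      <⟨ ℕP.*-monoˡ-< (N ℕ.^ 4) {{ℕP.m^n≢0 N 4 {{N≢0}}}} (ℕP.m≤m+n 17 47) ⟩
    64 ℕ.* N ℕ.^ 4      ≤⟨ ℕP.*-monoˡ-≤ (N ℕ.^ 4) (ℕP.^-monoˡ-≤ 3 4≤N) ⟩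
    N ℕ.^ 3 ℕ.* N ℕ.^ 4 ≡⟨ ℕP.^-distribˡ-+-* N 3 4 ⟨
    N ℕ.^ 7             ≤⟨ h ⟩
    P ℕ.^ 4             ≤⟨ ^-mono-*-≤ 4 2 N (ℕP.<⇒≤ P<2N) ⟩
    16 ℕ.* N ℕ.^ 4      ∎)
    where
    open ℕP.≤-Reasoning
    N≢0 : NonZero N
    N≢0 = ℕ.>-nonZero (ℕP.≤-trans (s≤s z≤n) 4≤N)

  growth₃ : ∀ {N P F} → 1 ℕ.≤ N → N ℕ.^ 7 ℕ.≤ P ℕ.^ 4 → N ℕ.* N ℕ.≤ 9 ℕ.* F ⊎ P ℕ.≤ 9 ℕ.* F →
    N ℕ.^ 7 ℕ.≤ 9 ℕ.^ 4 ℕ.* F ℕ.^ 4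
  growth₃ {N} {P} {F} 1≤N h (inj₁ k) = begin
    N ℕ.^ 7                       ≤⟨ ℕP.^-monoʳ-≤ N {{ℕ.>-nonZero 1≤N}} (ℕP.m≤m+n 7 1) ⟩
    N ℕ.^ 8                       ≡⟨ ℕP.^-distribˡ-+-* N 4 4 ⟩
    N ℕ.^ 4 ℕ.* N ℕ.^ 4           ≡⟨ ^-distribʳ-* 4 N N ⟨
    (N ℕ.* N) ℕ.^ 4               ≤⟨ ^-mono-*-≤ 4 9 F k ⟩
    9 ℕ.^ 4 ℕ.* F ℕ.^ 4           ∎
    where open ℕP.≤-Reasoning
  growth₃ {N} {P} {F} _ h (inj₂ k) = ℕP.≤-trans h (^-mono-*-≤ 4 9 F k)

  -- Here x stands for 2^k. The hypothesis has exponent 45x / `D`, and the conclusion has `E` /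
  -- (90x), since 5/2 + 1/90 = 226/90. Both 90x ≤ `D` and `E` ≤ 2 `D` come down to 137 ≤ 46x.
  module Exponents (x : ℕ) (4≤x : 4 ℕ.≤ x) where

    137≤46x : 137 ℕ.≤ 46 ℕ.* x
    137≤46x = ℕP.≤-trans (ℕP.m≤m+n 137 47) (ℕP.*-monoʳ-≤ 46 4≤x)

    D = 136 ℕ.* x ℕ.∸ 137
    E = 226 ℕ.* x ℕ.∸ 137

    D+137 : D ℕ.+ 137 ≡ 136 ℕ.* x
    D+137 = ℕP.m∸n+n≡m (ℕP.≤-trans 137≤46x (ℕP.*-monoˡ-≤ x (ℕP.m≤m+n 46 90)))

    90x≤D : 90 ℕ.* x ℕ.≤ D
    90x≤D = ℕP.+-cancelʳ-≤ 137 (90 ℕ.* x) D (begin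
      90 ℕ.* x ℕ.+ 137       ≤⟨ ℕP.+-monoʳ-≤ (90 ℕ.* x) 137≤46x ⟩
      90 ℕ.* x ℕ.+ 46 ℕ.* x  ≡⟨ ℕP.*-distribʳ-+ x 90 46 ⟨
      136 ℕ.* x              ≡⟨ D+137 ⟨
      D ℕ.+ 137              ∎)
      where open ℕP.≤-Reasoning

    E≤2D : E ℕ.≤ D ℕ.* 2
    E≤2D = ℕP.m≤n+o⇒m∸n≤o (226 ℕ.* x) 137 (ℕP.+-cancelʳ-≤ 137 _ _ (begin
      226 ℕ.* x ℕ.+ 137          ≤⟨ ℕP.+-monoʳ-≤ (226 ℕ.* x) 137≤46x ⟩
      226 ℕ.* x ℕ.+ 46 ℕ.* x     ≡⟨ ℕP.*-distribʳ-+ x 226 46 ⟨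
      272 ℕ.* x                  ≡⟨ ℕP.*-distribʳ-+ x 136 136 ⟩
      136 ℕ.* x ℕ.+ 136 ℕ.* x    ≡⟨ cong₂ ℕ._+_ D+137 D+137 ⟨
      D ℕ.+ 137 ℕ.+ (D ℕ.+ 137)  ≡⟨ regroup D 137 ⟩
      137 ℕ.+ D ℕ.* 2 ℕ.+ 137    ∎))
      where
      open ℕP.≤-Reasoning
      regroup : ∀ d c → d ℕ.+ c ℕ.+ (d ℕ.+ c) ≡ c ℕ.+ d ℕ.* 2 ℕ.+ c
      regroup = ℕsolve-∀

    double-45 : 45 ℕ.* x ℕ.* 2 ≡ 90 ℕ.* x
    double-45 = trans (ℕP.*-comm (45 ℕ.* x) 2) (sym (ℕP.*-assoc 2 45 x))

    square≤ : ∀ {N P} → 1 ℕ.≤ N → N ℕ.^ D ℕ.≤ P ℕ.^ (45 ℕ.* x) → N ℕ.* N ℕ.≤ P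
    square≤ {N} {P} 1≤N h = ℕP.≮⇒≥ λ P<N² → ℕP.<-irrefl refl (begin-strict
      P ℕ.^ (45 ℕ.* x)         <⟨ ℕP.^-monoˡ-< (45 ℕ.* x) {{45x≢0}} P<N² ⟩
      (N ℕ.* N) ℕ.^ (45 ℕ.* x) ≡⟨ ^-distribʳ-* (45 ℕ.* x) N N ⟩
      N ℕ.^ (45 ℕ.* x) ℕ.* N ℕ.^ (45 ℕ.* x) ≡⟨ ℕP.^-distribˡ-+-* N (45 ℕ.* x) (45 ℕ.* x) ⟨
      N ℕ.^ (45 ℕ.* x ℕ.+ 45 ℕ.* x)         ≡⟨ cong (N ℕ.^_) (ℕP.*-distribʳ-+ x 45 45) ⟨
      N ℕ.^ (90 ℕ.* x)         ≤⟨ ℕP.^-monoʳ-≤ N {{ℕ.>-nonZero 1≤N}} 90x≤D ⟩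
      N ℕ.^ D                  ≤⟨ h ⟩
      P ℕ.^ (45 ℕ.* x)         ∎)
      where
      open ℕP.≤-Reasoning
      45x≢0 : NonZero (45 ℕ.* x)
      45x≢0 = ℕ.>-nonZero (ℕP.≤-trans (s≤s z≤n) (ℕP.*-monoʳ-≤ 45 (ℕP.≤-trans (s≤s z≤n) 4≤x)))

    -- A cubic bound is ample, as `E` ≤ 270x. If instead F is of order P, the square of the
    -- hypothesis suffices by `E` ≤ 2 `D`.
    growth₅ : ∀ {N P F} → 1 ℕ.≤ N → N ℕ.^ D ℕ.≤ P ℕ.^ (45 ℕ.* x) →
      N ℕ.* (N ℕ.* N) ℕ.≤ 32 ℕ.* F ⊎ P ℕ.≤ 32 ℕ.* F →
      N ℕ.^ E ℕ.≤ 32 ℕ.^ (90 ℕ.* x) ℕ.* F ℕ.^ (90 ℕ.* x)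
    growth₅ {N} {P} {F} 1≤N h (inj₁ k) = begin
      N ℕ.^ E                             ≤⟨ ℕP.^-monoʳ-≤ N {{ℕ.>-nonZero 1≤N}} E≤e+e+e ⟩
      N ℕ.^ (e ℕ.+ (e ℕ.+ e))             ≡⟨ ℕP.^-distribˡ-+-* N e (e ℕ.+ e) ⟩
      N ℕ.^ e ℕ.* N ℕ.^ (e ℕ.+ e)         ≡⟨ cong (N ℕ.^ e ℕ.*_) (ℕP.^-distribˡ-+-* N e e) ⟩
      N ℕ.^ e ℕ.* (N ℕ.^ e ℕ.* N ℕ.^ e)   ≡⟨ cong (N ℕ.^ e ℕ.*_) (^-distribʳ-* e N N) ⟨
      N ℕ.^ e ℕ.* (N ℕ.* N) ℕ.^ e         ≡⟨ ^-distribʳ-* e N (N ℕ.* N) ⟨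
      (N ℕ.* (N ℕ.* N)) ℕ.^ e             ≤⟨ ^-mono-*-≤ e 32 F k ⟩
      32 ℕ.^ e ℕ.* F ℕ.^ e                ∎
      where
      open ℕP.≤-Reasoning
      e = 90 ℕ.* x
      E≤e+e+e : E ℕ.≤ e ℕ.+ (e ℕ.+ e)
      E≤e+e+e = ℕP.≤-trans (ℕP.m∸n≤m (226 ℕ.* x) 137)
        (ℕP.≤-trans (ℕP.*-monoˡ-≤ x (ℕP.m≤m+n 226 44))
          (ℕP.≤-reflexive (trans (ℕP.*-distribʳ-+ x 90 180) (cong (e ℕ.+_) (ℕP.*-distribʳ-+ x 90 90)))))
    growth₅ {N} {P} {F} 1≤N h (inj₂ k) = begin
      N ℕ.^ E                                ≤⟨ ℕP.^-monoʳ-≤ N {{ℕ.>-nonZero 1≤N}} E≤2D ⟩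
      N ℕ.^ (D ℕ.* 2)                        ≡⟨ ℕP.^-*-assoc N D 2 ⟨
      (N ℕ.^ D) ℕ.^ 2                        ≤⟨ ℕP.^-monoˡ-≤ 2 h ⟩
      (P ℕ.^ (45 ℕ.* x)) ℕ.^ 2               ≡⟨ ℕP.^-*-assoc P (45 ℕ.* x) 2 ⟩
      P ℕ.^ (45 ℕ.* x ℕ.* 2)                 ≡⟨ cong (P ℕ.^_) double-45 ⟩
      P ℕ.^ (90 ℕ.* x)                       ≤⟨ ^-mono-*-≤ (90 ℕ.* x) 32 F k ⟩
      32 ℕ.^ (90 ℕ.* x) ℕ.* F ℕ.^ (90 ℕ.* x) ∎
      where open ℕP.≤-Reasoning

  -- Arithmetic, polynomials and divided differences modulo p.

  module _ {p : ℕ} (pr : Prime p) where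

    infix 4 p∣_ _≈_ _≈?_

    p∣_ : ℤ → Set
    p∣ a = + p ∣ a

    _≈_ : ℤ → ℤ → Set
    a ≈ b = p∣ (a - b)

    _≈?_ : ∀ a b → Dec (a ≈ b)
    a ≈? b = + p ∣? (a - b)

    Distinct : List ℤ → Set
    Distinct = AllPairs (λ a b → ¬ a ≈ b)

    p∣-resp : ∀ {a b} → a ≡ b → p∣ a → p∣ b
    p∣-resp = subst p∣_

    p∣0 : p∣ + 0
    p∣0 = divides (+ 0) refl

    p∣p* : ∀ a → p∣ + p * a
    p∣p* a = divides a (ℤP.*-comm (+ p) a)

    ≈-refl : ∀ a → a ≈ a
    ≈-refl a = p∣-resp (sym (ℤP.+-inverseʳ a)) p∣0

    ≈-sym : ∀ {a b} → a ≈ b → b ≈ a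
    ≈-sym {a} {b} h = p∣-resp (flip-sub a b) (∣m⇒∣-m h)
      where
      flip-sub : ∀ a b → - (a - b) ≡ b - a
      flip-sub = solve-∀

    ≈-trans : ∀ {a b c} → a ≈ b → b ≈ c → a ≈ c
    ≈-trans {a} {b} {c} h k = p∣-resp (telescope a b c) (∣m∣n⇒∣m+n h k)
      where
      telescope : ∀ a b c → (a - b) + (b - c) ≡ a - c
      telescope = solve-∀

    p∣-*-split : ∀ a b → p∣ a * b → p∣ a ⊎ p∣ b
    p∣-*-split a b h with euclidsLemma ℤ.∣ a ∣ ℤ.∣ b ∣ pr (subst (p ℕD.∣_) (ℤP.abs-* a b) (∣⇒∣ᵤ h))
    ... | inj₁ k = inj₁ (∣ᵤ⇒∣ k)
    ... | inj₂ k = inj₂ (∣ᵤ⇒∣ k)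

    p∣-*-cancel : ∀ a {b} → ¬ p∣ a → p∣ a * b → p∣ b
    p∣-*-cancel a {b} ∤a h with p∣-*-split a b h
    ... | inj₁ k = contradiction k ∤a
    ... | inj₂ k = k

    p∤-small : ∀ {n} → 0 ℕ.< n → n ℕ.< p → ¬ p∣ + n
    p∤-small {suc n} _ n<p h = ℕP.<-irrefl refl (ℕP.<-≤-trans n<p (ℕD.∣⇒≤ (∣⇒∣ᵤ h)))

    0<p : 0 ℕ.< p
    0<p = ℕ.>-nonZero⁻¹ p {{prime⇒nonZero pr}}

    binomialSum≈1 : ∀ x m → suc m ℕ.≤ p → binomialSum p x (suc m) ≈ + 1
    binomialSum≈1 x zero    _   = ≈-refl (+ 1)
    binomialSum≈1 x (suc m) m<p = p∣-resp (regroup (binomialSum p x (suc m)) _)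
      (∣m∣n⇒∣m+n (binomialSum≈1 x m (ℕP.<⇒≤ m<p))
        (∣m⇒∣m*n {m = + (p C suc m)} (x ^ suc m) (∣ᵤ⇒∣ (prime∣C pr (s≤s z≤n) m<p))))
      where
      regroup : ∀ s t → (s - + 1) + t ≡ (s + t) - + 1
      regroup = solve-∀

    freshman : ∀ x → (+ 1 + x) ^ p ≈ + 1 + x ^ p
    freshman x = p∣-resp
      (trans (regroup (binomialSum p x p) (x ^ p))
        (cong (λ t → t - (+ 1 + x ^ p))
          (trans (cong (λ c → binomialSum p x p + + c * x ^ p) (sym (nCn≡1 p))) (sym (binomial-theorem p x)))))
      (below p 0<p ℕP.≤-refl)
      where
      below : ∀ m → 0 ℕ.< m → m ℕ.≤ p → binomialSum p x m ≈ + 1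
      below (suc m) _ = binomialSum≈1 x m
      regroup : ∀ s t → s - + 1 ≡ (s + + 1 * t) - (+ 1 + t)
      regroup = solve-∀

    0^p : (+ 0) ^ p ≡ + 0
    0^p = go p 0<p
      where
      go : ∀ m → 0 ℕ.< m → (+ 0) ^ m ≡ + 0
      go (suc m) _ = refl

    fermat : ∀ x → x ^ p ≈ x
    fermat (+ zero)  = subst (_≈ + 0) (sym 0^p) (≈-refl (+ 0))
    fermat (+ suc n) = ≈-trans {(+ suc n) ^ p} (freshman (+ n))
      (p∣-resp (regroup (+ n) ((+ n) ^ p)) (fermat (+ n)))
      where
      regroup : ∀ x y → y - x ≡ (+ 1 + y) - (+ 1 + x)
      regroup = solve-∀
    -- For negative x the induction runs upward: `freshman` at x compares x with x + 1, which is
    -- nearer to 0.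
    fermat -[1+ n ] = p∣-resp (regroup -[1+ n ] (-[1+ n ] ^ p) ((+ 1 + -[1+ n ]) ^ p))
      (∣m∣n⇒∣m-n (previous n) (freshman -[1+ n ]))
      where
      previous : ∀ n → (+ 1 + -[1+ n ]) ^ p ≈ + 1 + -[1+ n ]
      previous zero    = fermat (+ 0)
      previous (suc n) = fermat -[1+ n ]
      regroup : ∀ x y w → (w - (+ 1 + x)) - (w - (+ 1 + y)) ≡ y - x
      regroup = solve-∀

    -- Roots incongruent to r pass to the quotient because p is prime. The conclusion holds at every
    -- integer, in particular at slopes about which nothing was assumed.
    poly-roots : ∀ j {g} → Poly j g → ∀ rs → Distinct rs → j ℕ.≤ length rs →
      All (λ r → p∣ g r) rs → ∀ x → p∣ g x
    poly-roots zero    P rs _ _ _ x = p∣-resp (sym (P x)) p∣0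
    poly-roots (suc j) {g} P (r ∷ rs) (r# ∷ rs#) (s≤s j≤) (gr ∷ grs) x with P r
    ... | q , Q , eq = p∣-resp (sym (eq x)) (∣m∣n⇒∣m+n gr (∣n⇒∣m*n (x - r)
            (poly-roots j Q rs rs# j≤ (All.zipWith (λ (n , v) → quotient-root n v) (r# , grs)) x)))
      where
      cancel : ∀ a b → (a + b) - a ≡ b
      cancel = solve-∀
      quotient-root : ∀ {s} → ¬ r ≈ s → p∣ g s → p∣ q s
      quotient-root {s} r≉s gs = p∣-*-cancel (s - r) (λ h → r≉s (≈-sym {s} h))
        (p∣-resp (cancel (g r) _) (∣m∣n⇒∣m-n (p∣-resp (eq s) gs) gr))

    -- x^(e+p) and x^(e+1) agree modulo p at each node, and at incongruent nodes the values
    -- determine the divided difference, its denominators being invertible.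
    DD-fermat : ∀ e L → Distinct L → DD (e ℕ.+ p) L ≈ DD (suc e) L
    DD-fermat e [] _ = subst (λ d → d ≈ + 0) (sym (DD-nil (e ℕ.+ p))) (≈-refl (+ 0))
      where
      DD-nil : ∀ E → DD E [] ≡ + 0
      DD-nil zero    = refl
      DD-nil (suc E) = refl
    DD-fermat e (y ∷ []) _ = p∣-resp
      (trans (factor (y ^ e) (y ^ p) y)
        (cong₂ _-_ (trans (sym (ℤP.^-distribˡ-+-* y e p)) (sym (DD-power (e ℕ.+ p) y)))
                   (sym (DD-power (suc e) y))))
      (∣n⇒∣m*n (y ^ e) (fermat y))
      where
      factor : ∀ a b y → a * (b - y) ≡ a * b - y * a
      factor = solve-∀
    DD-fermat e (y ∷ z ∷ L) ((y≉z ∷ y#) ∷ (z# ∷ L#)) = p∣-*-cancel (y - z) y≉z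
      (p∣-resp (sym (trans (distrib (y - z) (DD (e ℕ.+ p) (y ∷ z ∷ L)) (DD (suc e) (y ∷ z ∷ L)))
                     (trans (cong₂ _-_ (DD-diff (e ℕ.+ p) y z L) (DD-diff (suc e) y z L))
                            (regroup (DD (e ℕ.+ p) (y ∷ L)) (DD (e ℕ.+ p) (z ∷ L)) (DD (suc e) (y ∷ L)) (DD (suc e) (z ∷ L))))))
        (∣m∣n⇒∣m-n (DD-fermat e (y ∷ L) (y# ∷ L#)) (DD-fermat e (z ∷ L) (z# ∷ L#))))
      where
      distrib : ∀ d a b → d * (a - b) ≡ d * a - d * b
      distrib = solve-∀
      regroup : ∀ a b c d → (a - b) - (c - d) ≡ (a - c) - (b - d)
      regroup = solve-∀

    -- Discarding nodes shortens a run of vanishing divided differences by one at a time.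
    Vanishing : ℕ → List ℤ → Set
    Vanishing s L = ∀ i → i ℕ.+ s ℕ.≤ length L → p∣ DD (i ℕ.+ p) L

    vanishing-tail : ∀ {s w L} → Vanishing s (w ∷ L) → Vanishing s L
    vanishing-tail {s} {w} {L} V i h = p∣-resp (cancel (DD (i ℕ.+ p) L) w (DD (i ℕ.+ p) (w ∷ L)))
      (∣m∣n⇒∣m-n (V (suc i) (s≤s h)) (∣n⇒∣m*n w (V i (ℕP.m≤n⇒m≤1+n h))))
      where
      cancel : ∀ a w b → (a + w * b) - w * b ≡ a
      cancel = solve-∀

    vanishing-second : ∀ {s y w L} → Vanishing s (y ∷ w ∷ L) → Vanishing s (y ∷ L)
    vanishing-second {s} {y} {w} {L} V =
      vanishing-tail (λ i h → p∣-resp (DD-swap (i ℕ.+ p) y w L) (V i h))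

    vanishing-drop : ∀ {s y} L {Y} → Vanishing s (y ∷ L ++ Y) → Vanishing s (y ∷ Y)
    vanishing-drop []      V = V
    vanishing-drop (w ∷ L) V = vanishing-drop L (vanishing-second V)

    -- Used with `L` the intercepts of one column of the grid: y remains free to range over that
    -- column, and this freedom drives the descent below.
    vanishing-select : ∀ {s y} L {Y} → y ∈ L → Vanishing s (L ++ Y) → Vanishing s (y ∷ Y)
    vanishing-select (w ∷ L) (here refl) V = vanishing-drop L V
    vanishing-select (w ∷ L) (there y∈L) V = vanishing-select L y∈L (vanishing-tail V)

    sumDD-const : ∀ E (Y : List ℤ) zs c → All (λ z → DD E (z ∷ Y) ≈ c) zs →
      sumDD E zs Y ≈ + length zs * c
    sumDD-const E Y []       c []       = ≈-refl (+ 0)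
    sumDD-const E Y (z ∷ zs) c (h ∷ hs) = p∣-resp
      (regroup (DD E (z ∷ Y)) (sumDD E zs Y) (+ length zs) c)
      (∣m∣n⇒∣m+n h (sumDD-const E Y zs c hs))
      where
      regroup : ∀ a b n c → (a - c) + (b - n * c) ≡ (a + b) - (+ 1 + n) * c
      regroup = solve-∀

    -- The function y ↦ DD p (y ∷ Y) is constant on bs because the divided difference with one
    -- more node vanishes, and the constant is 0 since p * DD (p - 1) Y = length Y * constant.
    vanishing-descent : ∀ bs Y → All (_∈ bs) Y → length Y ℕ.< p →
      (∀ {y} → y ∈ bs → p∣ DD p (y ∷ Y)) → ∀ {y y′} → y ∈ bs → y′ ∈ bs → y ≈ y′
    vanishing-descent bs [] _ _ V {y} {y′} y∈ y′∈ = ≈-trans {y} {+ 0} {y′} (vanish y∈) (≈-sym {y′} {+ 0} (vanish y′∈))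
      where
      cancel : ∀ a b → a - (a - b) ≡ b - + 0
      cancel = solve-∀
      vanish : ∀ {y} → y ∈ bs → y ≈ + 0
      vanish {y} h = p∣-resp (cancel (y ^ p) y) (∣m∣n⇒∣m-n (p∣-resp (DD-power p y) (V h)) (fermat y))
    vanishing-descent bs (w ∷ Y) (w∈ ∷ Y∈) l<p V = continue Y Y∈ (ℕP.<⇒≤ l<p) constant
      where
      constant : ∀ {y} → y ∈ bs → DD p (y ∷ Y) ≈ DD p (w ∷ Y)
      constant {y} y∈ = p∣-resp (DD-diff p y w Y) (∣n⇒∣m*n (y - w) (V y∈))
      continue : ∀ Y → All (_∈ bs) Y → length Y ℕ.< p →
        (∀ {y} → y ∈ bs → DD p (y ∷ Y) ≈ DD p (w ∷ Y)) → ∀ {y y′} → y ∈ bs → y′ ∈ bs → y ≈ y′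
      -- With no node left the factor `length Y` would be 0 and could not be cancelled, but
      -- constancy of y^p already gives y ≈ w by Fermat.
      continue [] _ _ K {y} {y′} y∈ y′∈ = ≈-trans {y} {w} {y′} (same y∈) (≈-sym {y′} {w} (same y′∈))
        where
        telescope : ∀ a b c d → ((a - b) - (a - c)) + (b - d) ≡ c - d
        telescope = solve-∀
        same : ∀ {y} → y ∈ bs → y ≈ w
        same {y} h = p∣-resp (telescope (y ^ p) (w ^ p) y w)
          (∣m∣n⇒∣m+n (∣m∣n⇒∣m-n (subst₂ _≈_ (DD-power p y) (DD-power p w) (K h)) (fermat y)) (fermat w))
      continue Y@(z ∷ Z) Y∈ l<p K = vanishing-descent bs Y Y∈ l<p
        (λ {y} y∈ → p∣-resp (cancel (DD p (y ∷ Y)) (DD p (w ∷ Y))) (∣m∣n⇒∣m+n (K y∈) const≈0))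
        where
        cancel : ∀ a b → (a - b) + b ≡ a
        cancel = solve-∀
        cancel′ : ∀ a b → a - (a - b) ≡ b
        cancel′ = solve-∀
        sum≈0 : p∣ sumDD p Y Y
        sum≈0 = go p refl
          where
          go : ∀ q → q ≡ p → p∣ sumDD q Y Y
          go zero    e = contradiction (subst (0 ℕ.<_) (sym e) 0<p) (λ ())
          go (suc q) e = p∣-resp (sym (DD-derivative q Y))
            (subst (λ t → p∣ + t * DD q Y) (sym e) (p∣p* (DD q Y)))
        const≈0 : p∣ DD p (w ∷ Y)
        const≈0 = p∣-*-cancel (+ length Y) (p∤-small (s≤s z≤n) l<p)
          (p∣-resp (cancel′ (sumDD p Y Y) _)
            (∣m∣n⇒∣m-n sum≈0 (sumDD-const p Y Y (DD p (w ∷ Y)) (All.map K Y∈))))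

    -- Points, lines of a given slope, and colliding pairs.

    Collide : ℤ → Point → Point → Set
    Collide ξ u v = intercept ξ u ≈ intercept ξ v

    collide? : ∀ ξ u v → Dec (Collide ξ u v)
    collide? ξ u v = intercept ξ u ≈? intercept ξ v

    Apart : Point → Point → Set
    Apart (a , b) (a′ , b′) = ¬ a ≈ a′ ⊎ ¬ b ≈ b′

    grid-apart : ∀ {as bs} → Distinct as → Distinct bs → AllPairs Apart (cartesianProduct as bs)
    grid-apart {[]}     {bs} []          bs# = []
    grid-apart {a ∷ as} {bs} (a# ∷ as#) bs# = AllPairsP.++⁺
      (AllPairsP.map⁺ (AllPairs.map inj₂ bs#))
      (grid-apart as# bs#)
      (AllP.map⁺ (All.universal (λ b → All.tabulate
        λ {v} v∈ → inj₁ (All.lookup a# (proj₁ (∈-cartesianProduct⁻ as bs v∈)))) bs))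

    collide-vertical : ∀ ξ {a b a′ b′} → Collide ξ (a , b) (a′ , b′) → a ≈ a′ → b ≈ b′
    collide-vertical ξ {a} {b} {a′} {b′} h a≈a′ =
      p∣-resp (regroup ξ a b a′ b′) (∣m∣n⇒∣m+n h (∣n⇒∣m*n ξ a≈a′))
      where
      regroup : ∀ ξ a b a′ b′ → ((b - ξ * a) - (b′ - ξ * a′)) + ξ * (a - a′) ≡ b - b′
      regroup = solve-∀

    apart-collide : ∀ ξ {a b a′ b′} → Apart (a , b) (a′ , b′) → Collide ξ (a , b) (a′ , b′) → ¬ a ≈ a′
    apart-collide ξ (inj₁ a≉a′) _ = a≉a′
    apart-collide ξ {a} {b} {a′} {b′} (inj₂ b≉b′) h = λ a≈a′ → b≉b′ (collide-vertical ξ {a} {b} {a′} {b′} h a≈a′)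

    one-slope : ∀ {u v ξ ζ} → Apart u v → Collide ξ u v → Collide ζ u v → ξ ≈ ζ
    one-slope {a , b} {a′ , b′} {ξ} {ζ} u#v h k
      with p∣-*-split (ξ - ζ) (a - a′) (p∣-resp (regroup ξ ζ a b a′ b′) (∣m∣n⇒∣m-n k h))
      where
      regroup : ∀ ξ ζ a b a′ b′ →
        ((b - ζ * a) - (b′ - ζ * a′)) - ((b - ξ * a) - (b′ - ξ * a′)) ≡ (ξ - ζ) * (a - a′)
      regroup = solve-∀
    ... | inj₁ ξ≈ζ  = ξ≈ζ
    ... | inj₂ a≈a′ = contradiction a≈a′ (apart-collide ξ {a} {b} {a′} {b′} u#v h)

    hit : ℤ → Point → Point → ℕ
    hit ξ u v with collide? ξ u v
    ... | yes _ = 1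
    ... | no  _ = 0

    hit-yes : ∀ {ξ u v} → Collide ξ u v → hit ξ u v ≡ 1
    hit-yes {ξ} {u} {v} h with collide? ξ u v
    ... | yes _ = refl
    ... | no ¬h = contradiction h ¬h

    hit-no : ∀ {ξ u v} → ¬ Collide ξ u v → hit ξ u v ≡ 0
    hit-no {ξ} {u} {v} ¬h with collide? ξ u v
    ... | yes h = contradiction h ¬h
    ... | no _  = refl

    hits : ℤ → Point → List Point → ℕ
    hits ξ u V = sum (map (hit ξ u) V)

    collisions : ℤ → List Point → ℕ
    collisions ξ []      = 0
    collisions ξ (u ∷ U) = hits ξ u U ℕ.+ collisions ξ U

    hits-positive : ∀ {ξ u V} → Any (Collide ξ u) V → 1 ℕ.≤ hits ξ u V
    hits-positive (here h)  = ℕP.≤-trans (ℕP.≤-reflexive (sym (hit-yes h))) (ℕP.m≤m+n _ _)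
    hits-positive (there h) = ℕP.≤-trans (hits-positive h) (ℕP.m≤n+m _ _)

    -- The last point of the list on each line of slope ξ that meets it, so the length is the number
    -- of these lines.
    representatives : ℤ → List Point → List Point
    representatives ξ []      = []
    representatives ξ (u ∷ U) with any? (collide? ξ u) U
    ... | yes _ = representatives ξ U
    ... | no  _ = u ∷ representatives ξ U

    representatives-All : ∀ {P : Point → Set} ξ {U} → All P U → All P (representatives ξ U)
    representatives-All ξ []           = []
    representatives-All ξ {u ∷ U} (h ∷ hs) with any? (collide? ξ u) U
    ... | yes _ = representatives-All ξ hs
    ... | no  _ = h ∷ representatives-All ξ hs

    representatives-distinct : ∀ ξ U → AllPairs (λ u v → ¬ Collide ξ u v) (representatives ξ U)
    representatives-distinct ξ []      = []
    representatives-distinct ξ (u ∷ U) with any? (collide? ξ u) U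
    ... | yes _ = representatives-distinct ξ U
    ... | no ¬h = representatives-All ξ (AllP.¬Any⇒All¬ U ¬h) ∷ representatives-distinct ξ U

    -- Each omitted point collides with a later one and so accounts for a colliding pair of its own.
    length≤representatives+collisions : ∀ ξ U →
      length U ℕ.≤ length (representatives ξ U) ℕ.+ collisions ξ U
    length≤representatives+collisions ξ []      = z≤n
    length≤representatives+collisions ξ (u ∷ U) with any? (collide? ξ u) U
    ... | yes h = ℕP.≤-trans (ℕP.+-mono-≤ (hits-positive h) (length≤representatives+collisions ξ U))
                    (ℕP.≤-reflexive (swap (hits ξ u U) (length (representatives ξ U)) (collisions ξ U)))
      where
      swap : ∀ a b c → a ℕ.+ (b ℕ.+ c) ≡ b ℕ.+ (a ℕ.+ c)
      swap = ℕsolve-∀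
    ... | no ¬h = s≤s (ℕP.≤-trans (length≤representatives+collisions ξ U)
                    (ℕP.+-monoʳ-≤ (length (representatives ξ U)) (ℕP.m≤n+m (collisions ξ U) (hits ξ u U))))

    no-collisions : ∀ ξ U → collisions ξ U ≡ 0 → Distinct (map (intercept ξ) U)
    no-collisions ξ []      _ = []
    no-collisions ξ (u ∷ U) e =
      AllP.map⁺ (AllP.¬Any⇒All¬ U λ h → contradiction
        (subst (1 ℕ.≤_) (ℕP.m+n≡0⇒m≡0 (hits ξ u U) e) (hits-positive h)) λ ())
      ∷ no-collisions ξ U (ℕP.m+n≡0⇒n≡0 (hits ξ u U) e)

    some-collision : ∀ ξ {U} → AllPairs Apart U → ¬ collisions ξ U ≡ 0 →
      ∃[ u ] ∃[ v ] u ∈ U × v ∈ U × Apart u v × Collide ξ u v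
    some-collision ξ []         e = contradiction refl e
    some-collision ξ {u ∷ U} (u# ∷ U#) e with any? (collide? ξ u) U
    ... | yes h with find h
    ...   | v , v∈ , k = u , v , here refl , there v∈ , All.lookup u# v∈ , k
    some-collision ξ {u ∷ U} (u# ∷ U#) e | no ¬h
      with some-collision ξ U# (λ e′ → e (cong₂ ℕ._+_
             (sum-map-zero (hit ξ u) (All.map hit-no (AllP.¬Any⇒All¬ U ¬h))) e′))
    ... | w , v , w∈ , v∈ , w#v , k = w , v , there w∈ , there v∈ , w#v , k

    total-hit≤1 : ∀ {u v Ξ} → Apart u v → Distinct Ξ → sum (map (λ ξ → hit ξ u v) Ξ) ℕ.≤ 1
    total-hit≤1 u#v [] = z≤n
    total-hit≤1 {u} {v} {ξ ∷ Ξ} u#v (ξ# ∷ Ξ#) with collide? ξ u v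
    ... | no  _ = total-hit≤1 u#v Ξ#
    ... | yes h = s≤s (ℕP.≤-reflexive (sum-map-zero (λ ζ → hit ζ u v)
                    (All.map (λ {ζ} ξ≉ζ → hit-no {ζ} {u} {v} λ k → ξ≉ζ (one-slope {u} {v} {ξ} {ζ} u#v h k)) ξ#)))

    total-hits : ∀ {u V Ξ} → All (Apart u) V → Distinct Ξ →
      sum (map (λ ξ → hits ξ u V) Ξ) ℕ.≤ length V
    total-hits {u} {[]} {Ξ} [] Ξ# =
      ℕP.≤-reflexive (sum-map-zero (λ ξ → hits ξ u []) (All.universal (λ _ → refl) Ξ))
    total-hits {u} {v ∷ V} {Ξ} (u#v ∷ u#) Ξ# = ℕP.≤-trans
      (ℕP.≤-reflexive (sum-map-+ (λ ξ → hit ξ u v) (λ ξ → hits ξ u V) Ξ))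
      (ℕP.+-mono-≤ (total-hit≤1 u#v Ξ#) (total-hits u# Ξ#))

    -- A pair of distinct points lies on a common line for at most one slope, so summing over slopes
    -- counts each pair at most once.
    total-collisions : ∀ {U Ξ} → AllPairs Apart U → Distinct Ξ →
      sum (map (λ ξ → collisions ξ U) Ξ) ℕ.≤ triangle (length U)
    total-collisions {[]} {Ξ} [] Ξ# =
      ℕP.≤-reflexive (sum-map-zero (λ ξ → collisions ξ []) (All.universal (λ _ → refl) Ξ))
    total-collisions {u ∷ U} {Ξ} (u# ∷ U#) Ξ# = ℕP.≤-trans
      (ℕP.≤-reflexive (sum-map-+ (λ ξ → hits ξ u U) (λ ξ → collisions ξ U) Ξ))
      (ℕP.+-mono-≤ (total-hits u# Ξ#) (total-collisions U# Ξ#))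

    -- The number of slopes determined by a grid.

    residues : List ℤ
    residues = map +_ (upTo p)

    residues-separate : ∀ {i j} → i ℕ.< j → j ℕ.< p → ¬ (+ i) ≈ (+ j)
    residues-separate {i} {j} i<j j<p h = p∤-small (ℕP.m<n⇒0<n∸m i<j) (ℕP.≤-<-trans (ℕP.m∸n≤m j i) j<p)
      (p∣-resp (trans (ℤP.m-n≡m⊖n j i) (ℤP.⊖-≥ (ℕP.<⇒≤ i<j))) (≈-sym {+ i} {+ j} h))

    residues-distinct : Distinct residues
    residues-distinct = AllPairsP.map⁺ (AllPairsP.applyUpTo⁺₁ id p residues-separate)

    injective? : ∀ U → Decidable (λ ξ → collisions ξ U ≡ 0)
    injective? U ξ = collisions ξ U ℕP.≟ 0

    slopes : List Point → List ℤ
    slopes U = filter (∁? (injective? U)) residues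

    injectiveSlopes : List Point → List ℤ
    injectiveSlopes U = filter (injective? U) residues

    slopes-count : ∀ U → length (injectiveSlopes U) ℕ.+ length (slopes U) ≡ p
    slopes-count U = trans (length-filter-∁ (injective? U) residues)
      (trans (length-map +_ (upTo p)) (length-upTo p))

    -- A divided difference of the intercepts vanishes by Fermat for every injective slope; as a
    -- polynomial in the slope it has smaller degree than the number of those slopes.
    intercepts-vanishing : ∀ U → length U ℕ.≤ p →
      Vanishing (length (slopes U) ℕ.+ 3) (map (intercept (+ 0)) U)
    intercepts-vanishing U n≤p i h = poly-roots j (DD-poly j (i ℕ.+ p) U degree) (injectiveSlopes U)
      (AllPairsP.filter⁺ (injective? U) residues-distinct) enough
      (All.map (λ {ξ} → vanish ξ) (AllP.all-filter (injective? U) residues)) (+ 0)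
      where
      n = length U
      m = length (slopes U)
      j = suc (suc (i ℕ.+ p)) ℕ.∸ n
      h′ : i ℕ.+ (m ℕ.+ 3) ℕ.≤ n
      h′ = subst (i ℕ.+ (m ℕ.+ 3) ℕ.≤_) (length-map (intercept (+ 0)) U) h
      degree : j ℕ.+ n ≡ suc (suc (i ℕ.+ p))
      degree = ℕP.m∸n+n≡m (ℕP.≤-trans n≤p (ℕP.≤-trans (ℕP.m≤n+m p i) (ℕP.m≤n+m (i ℕ.+ p) 2)))
      rearrange : ∀ i g m → suc (suc (suc (i ℕ.+ (g ℕ.+ m)))) ≡ g ℕ.+ (i ℕ.+ (m ℕ.+ 3))
      rearrange = ℕsolve-∀
      enough : j ℕ.≤ length (injectiveSlopes U)
      enough = ℕP.m≤n+o⇒m∸n≤o (suc (suc (i ℕ.+ p))) n (begin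
        suc (suc (i ℕ.+ p))                                        ≤⟨ ℕP.n≤1+n _ ⟩
        suc (suc (suc (i ℕ.+ p)))                                  ≡⟨ cong (λ q → suc (suc (suc (i ℕ.+ q)))) (slopes-count U) ⟨
        suc (suc (suc (i ℕ.+ (length (injectiveSlopes U) ℕ.+ m)))) ≡⟨ rearrange i (length (injectiveSlopes U)) m ⟩
        length (injectiveSlopes U) ℕ.+ (i ℕ.+ (m ℕ.+ 3))           ≤⟨ ℕP.+-monoʳ-≤ _ h′ ⟩
        length (injectiveSlopes U) ℕ.+ n                           ≡⟨ ℕP.+-comm _ n ⟩
        n ℕ.+ length (injectiveSlopes U)                           ∎)
        where open ℕP.≤-Reasoning
      -- The exponent has dropped to i + 1, and the degree is negative once i + 3 ≤ n; the 3 in the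
      -- offset ensures this even if m = 0.
      low : ∀ ξ → DD (suc i) (map (intercept ξ) U) ≡ + 0
      low ξ = DD-low (suc i) (map (intercept ξ) U) (begin
        suc (suc (suc i))        ≡⟨ ℕP.+-comm 3 i ⟩
        i ℕ.+ 3                  ≤⟨ ℕP.+-monoʳ-≤ i (ℕP.m≤n+m 3 m) ⟩
        i ℕ.+ (m ℕ.+ 3)          ≤⟨ h′ ⟩
        n                        ≡⟨ length-map (intercept ξ) U ⟨
        length (map (intercept ξ) U) ∎)
        where open ℕP.≤-Reasoning
      vanish : ∀ ξ → collisions ξ U ≡ 0 → p∣ DD (i ℕ.+ p) (map (intercept ξ) U)
      vanish ξ e = p∣-resp (trans (cong (_-_ (DD (i ℕ.+ p) (map (intercept ξ) U))) (low ξ)) (ℤP.+-identityʳ _))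
        (DD-fermat i (map (intercept ξ) U) (no-collisions ξ U e))

    intercept-0-grid : ∀ a as bs → map (intercept (+ 0)) (cartesianProduct (a ∷ as) bs)
      ≡ bs ++ map (intercept (+ 0)) (cartesianProduct as bs)
    intercept-0-grid a as bs = trans (map-++ (intercept (+ 0)) (map (a ,_) bs) (cartesianProduct as bs))
      (cong (_++ map (intercept (+ 0)) (cartesianProduct as bs))
        (trans (sym (map-∘ bs)) (trans (map-cong (λ b → ℤP.+-identityʳ b) bs) (map-id bs))))

    -- If there were fewer slopes, the divided difference of x^p would vanish at y followed by the
    -- slope-0 intercepts of all columns but the first, for each y in `bs`. These remaining nodes
    -- number less than p, so the descent makes y and y′ congruent.
    slopes-lower-bound : ∀ a as bs {y y′} → y ∈ bs → y′ ∈ bs → ¬ y ≈ y′ →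
      length (a ∷ as) ℕ.* length bs ℕ.≤ p →
      length as ℕ.* length bs ℕ.≤ suc (length (slopes (cartesianProduct (a ∷ as) bs)))
    slopes-lower-bound a as bs {y} {y′} y∈ y′∈ y≉y′ n≤p = ℕP.≮⇒≥ λ few → y≉y′
      (vanishing-descent bs Y Y∈ Y<p (λ {z} z∈ → vanishing-select bs z∈ V 0 (bound few)) y∈ y′∈)
      where
      U = cartesianProduct (a ∷ as) bs
      m = length (slopes U)
      Y = map (intercept (+ 0)) (cartesianProduct as bs)
      lengthY : length Y ≡ length as ℕ.* length bs
      lengthY = trans (length-map (intercept (+ 0)) (cartesianProduct as bs)) (length-cartesianProduct as bs)
      Y∈ : All (_∈ bs) Y
      Y∈ = AllP.map⁺ (All.tabulate λ {v} v∈ → subst (_∈ bs) (sym (ℤP.+-identityʳ (proj₂ v)))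
                       (proj₂ (∈-cartesianProduct⁻ as bs v∈)))
      Y<p : length Y ℕ.< p
      Y<p = ℕP.<-≤-trans (subst (ℕ._< length bs ℕ.+ length as ℕ.* length bs) (sym lengthY)
              (ℕP.m<n+m _ (∈-length y∈))) n≤p
      V : Vanishing (m ℕ.+ 3) (bs ++ Y)
      V = subst (Vanishing (m ℕ.+ 3)) (intercept-0-grid a as bs)
            (intercepts-vanishing U (subst (ℕ._≤ p) (sym (length-cartesianProduct (a ∷ as) bs)) n≤p))
      bound : suc m ℕ.< length as ℕ.* length bs → m ℕ.+ 3 ℕ.≤ length (y ∷ Y)
      bound few = subst₂ ℕ._≤_ (ℕP.+-comm 3 m) (cong suc (sym lengthY)) (s≤s few)

    -- The intercept along slope (b - b′)/(a - a′), multiplied by a - a′ to clear the denominator.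
    sheared : (a a′ b b′ : ℤ) → Point → ℤ
    sheared a a′ b b′ (x , y) = (a - a′) * y - (b - b′) * x

    -- Let n be the number of grid points. A slope with fewer than n/4 lines has more than 3n/4
    -- colliding pairs. As `as` has at least 4 elements, there are at least 3n/4 - 1 slopes; if all
    -- were like this, about 9n²/16 pairs would collide, more than the n(n - 1)/2 available. Since
    -- the good slope is not injective, a colliding pair yields a, a′, b, b′.
    rich-shear : ∀ as bs {y y′} → Distinct as → Distinct bs → 4 ℕ.≤ length as →
      y ∈ bs → y′ ∈ bs → ¬ y ≈ y′ →
      length as ℕ.* length bs ℕ.≤ p →
      ∃[ a ] ∃[ a′ ] ∃[ b ] ∃[ b′ ] ∃[ S ]
        (a ∈ as × a′ ∈ as × b ∈ bs × b′ ∈ bs) ×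
        All (_∈ cartesianProduct as bs) S ×
        AllPairs (λ u v → ¬ sheared a a′ b b′ u ≈ sheared a a′ b b′ v) S ×
        length as ℕ.* length bs ℕ.≤ 4 ℕ.* length S
    rich-shear (a₀ ∷ as) bs as# bs# 4≤as y∈ y′∈ y≉y′ n≤p
      with any? (λ ξ → n ℕ.≤? 4 ℕ.* length (representatives ξ U)) (slopes U)
      where
      U = cartesianProduct (a₀ ∷ as) bs
      n = length (a₀ ∷ as) ℕ.* length bs
    ... | no none = contradiction average
      (averaging-absurd {n} {m} {triangle (length U)} 4≤n many
        (subst (λ k → 2 ℕ.* triangle k ℕ.+ n ≡ n ℕ.* n) (sym |U|) (triangle-double n)))
      where
      U = cartesianProduct (a₀ ∷ as) bs
      n = length (a₀ ∷ as) ℕ.* length bs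
      m = length (slopes U)
      |U| : length U ≡ n
      |U| = length-cartesianProduct (a₀ ∷ as) bs
      4≤n : 4 ℕ.≤ n
      4≤n = ℕP.≤-trans 4≤as (ℕP.m≤m*n (length (a₀ ∷ as)) (length bs) {{ℕ.>-nonZero (∈-length y∈)}})
      many : 3 ℕ.* n ℕ.≤ 4 ℕ.* suc m
      many = ℕP.+-cancelˡ-≤ n _ _ (begin
        4 ℕ.* n                                            ≡⟨ ℕP.*-distribˡ-+ 4 (length bs) _ ⟩
        4 ℕ.* length bs ℕ.+ 4 ℕ.* (length as ℕ.* length bs) ≤⟨ ℕP.+-mono-≤ (ℕP.*-monoˡ-≤ (length bs) 4≤as)
                                                                 (ℕP.*-monoʳ-≤ 4 (slopes-lower-bound a₀ as bs y∈ y′∈ y≉y′ n≤p)) ⟩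
        n ℕ.+ 4 ℕ.* suc m                                  ∎)
        where open ℕP.≤-Reasoning
      each : ∀ {ξ} → ¬ n ℕ.≤ 4 ℕ.* length (representatives ξ U) → suc (3 ℕ.* n) ℕ.≤ 4 ℕ.* collisions ξ U
      each {ξ} ¬h = ℕP.+-cancelˡ-≤ n _ _ (begin
        n ℕ.+ suc (3 ℕ.* n)                   ≡⟨ ℕP.+-suc n (3 ℕ.* n) ⟩
        suc (4 ℕ.* n)                         ≤⟨ s≤s (ℕP.*-monoʳ-≤ 4
                                                 (subst (ℕ._≤ r ℕ.+ collisions ξ U) |U| (length≤representatives+collisions ξ U))) ⟩
        suc (4 ℕ.* (r ℕ.+ collisions ξ U))    ≡⟨ cong suc (ℕP.*-distribˡ-+ 4 r (collisions ξ U)) ⟩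
        suc (4 ℕ.* r) ℕ.+ 4 ℕ.* collisions ξ U ≤⟨ ℕP.+-monoˡ-≤ _ (ℕP.≰⇒> ¬h) ⟩
        n ℕ.+ 4 ℕ.* collisions ξ U            ∎)
        where
        open ℕP.≤-Reasoning
        r = length (representatives ξ U)
      average : m ℕ.* suc (3 ℕ.* n) ℕ.≤ 4 ℕ.* triangle (length U)
      average = ℕP.≤-trans
        (sum-map-≥ (λ ξ → collisions ξ U) (suc (3 ℕ.* n)) 4 (All.map each (AllP.¬Any⇒All¬ (slopes U) none)))
        (ℕP.*-monoʳ-≤ 4 (total-collisions (grid-apart as# bs#) (AllPairsP.filter⁺ (∁? (injective? U)) residues-distinct)))
    ... | yes some with find some
    ...   | ξ , ξ∈ , large with some-collision ξ (grid-apart as# bs#)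
              (proj₂ (∈-filter⁻ (∁? (injective? (cartesianProduct (a₀ ∷ as) bs))) {xs = residues} ξ∈))
    ...     | (a , b) , (a′ , b′) , u∈ , v∈ , u#v , coll =
      a , a′ , b , b′ , representatives ξ U ,
      (proj₁ (∈-cartesianProduct⁻ (a₀ ∷ as) bs u∈) , proj₁ (∈-cartesianProduct⁻ (a₀ ∷ as) bs v∈) ,
       proj₂ (∈-cartesianProduct⁻ (a₀ ∷ as) bs u∈) , proj₂ (∈-cartesianProduct⁻ (a₀ ∷ as) bs v∈)) ,
      representatives-All ξ (All.tabulate id) ,
      AllPairs.map (λ {u} {v} → shear-injective u v) (representatives-distinct ξ U) ,
      large
      where
      U = cartesianProduct (a₀ ∷ as) bs
      regroup : ∀ ξ a b a′ b′ x y z w →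
        (((a - a′) * y - (b - b′) * x) - ((a - a′) * w - (b - b′) * z))
          + ((b - ξ * a) - (b′ - ξ * a′)) * (x - z)
        ≡ (a - a′) * ((y - ξ * x) - (w - ξ * z))
      regroup = solve-∀
      -- The chosen pair gives b - b′ ≈ ξ (a - a′), so modulo p `sheared` is the intercept times the
      -- unit a - a′.
      shear-injective : ∀ u v → ¬ Collide ξ u v → ¬ sheared a a′ b b′ u ≈ sheared a a′ b b′ v
      shear-injective (x , y) (z , w) ¬h k = ¬h (p∣-*-cancel (a - a′) (apart-collide ξ {a} {b} {a′} {b′} u#v coll)
        (p∣-resp (regroup ξ a b a′ b′ x y z w) (∣m∣n⇒∣m+n k (∣m⇒∣m*n (x - z) coll))))

    two-distinct : ∀ {L} → Distinct L → 2 ℕ.≤ length L → ∃[ y ] ∃[ z ] y ∈ L × z ∈ L × ¬ y ≈ z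
    two-distinct {y ∷ z ∷ L} ((y≉z ∷ _) ∷ _) _ = y , z , here refl , there (here refl) , y≉z
    two-distinct {y ∷ []} _ (s≤s ())

    take-⊆ : ∀ {X : Set} n (L : List X) {x} → x ∈ take n L → x ∈ L
    take-⊆ (suc n) (y ∷ L) (here e)  = here e
    take-⊆ (suc n) (y ∷ L) (there h) = there (take-⊆ n L h)

    %ℕ≡⇒≈ : ∀ .{{_ : NonZero p}} {a b} → a %ℕ p ≡ b %ℕ p → a ≈ b
    %ℕ≡⇒≈ {a} {b} e = p∣-resp
      (trans (regroup (+ (b %ℕ p)) (a /ℕ p) (b /ℕ p) (+ p))
        (cong₂ _-_ (trans (cong (λ r → + r + a /ℕ p * + p) (sym e)) (sym (a≡a%ℕn+[a/ℕn]*n a p)))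
                   (sym (a≡a%ℕn+[a/ℕn]*n b p))))
      (p∣p* (a /ℕ p - b /ℕ p))
      where
      regroup : ∀ r q s P → P * (q - s) ≡ (r + q * P) - (r + s * P)
      regroup = solve-∀

    -- Families of matrices with entries in the given set.

    module _ .{{_ : NonZero p}} (A : Subset p) where

      values : List ℤ
      values = map (λ i → + toℕ i) (elems A)

      values-distinct : Distinct values
      values-distinct = AllPairsP.map⁺ (AllPairs.map separate
        (UniqueP.filter⁺ (_∈? A) (UniqueP.allFin⁺ p)))
        where
        order : ∀ {i j} → i ℕ.< p → j ℕ.< p → i ≢ j → ¬ (+ i) ≈ (+ j)
        order {i} {j} i<p j<p i≢j h with ℕP.<-cmp i j
        ... | tri≈ _ e _ = i≢j e
        ... | tri< l _ _ = residues-separate l j<p h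
        ... | tri> _ _ l = residues-separate l i<p (≈-sym {+ i} {+ j} h)
        separate : ∀ {i j : Fin p} → i ≢ j → ¬ (+ toℕ i) ≈ (+ toℕ j)
        separate {i} {j} i≢j = order (toℕ<n i) (toℕ<n j) (i≢j ∘ toℕ-injective)

      ∣A∣≡length-values : ∣ A ∣ ≡ length values
      ∣A∣≡length-values = trans (∣∣≡length-filter (_∈? A) A id id id) (sym (length-map _ (elems A)))

      Over : ∀ {d} → (Fin d → Fin d → ℤ) → Set
      Over M = ∀ i j → M i j ∈ values

      -- Matrices stay over ℤ, so that integer identities apply to them, and only determinants are
      -- compared modulo p. The passage to `Fin p` happens once, in `HasDeterminants⇒≤f`.
      HasDeterminants : ℕ → ℕ → Set
      HasDeterminants d n = ∃[ Ms ] All Over Ms × AllPairs (λ M N → ¬ det d M ≈ det d N) Ms × n ℕ.≤ length Ms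

      reduction : ∀ {d} {M : Fin d → Fin d → ℤ} → Over M → Mat p d
      reduction h = Vec.tabulate λ i → Vec.tabulate λ j → proj₁ (∈-map⁻ _ (h i j))

      reduction-∈ : ∀ {d} {M : Fin d → Fin d → ℤ} (h : Over M) → reduction h ∈ matricesOver d A
      reduction-∈ h = ∈-allVecs _ λ i → ∈-allVecs _ λ j →
        subst (_∈ elems A)
          (sym (trans (cong (λ v → lookup v j) (lookup∘tabulate _ i)) (lookup∘tabulate _ j)))
          (proj₁ (proj₂ (∈-map⁻ _ (h i j))))

      detFp-reduction : ∀ {d} {M : Fin d → Fin d → ℤ} (h : Over M) → detFp p d (reduction h) ≡ det d M %ℕ p
      detFp-reduction {d} h = cong (_%ℕ p) (det-cong d λ i j →
        trans (cong (λ x → + toℕ x) (trans (cong (λ v → lookup v j) (lookup∘tabulate _ i)) (lookup∘tabulate _ j)))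
              (sym (proj₂ (proj₂ (∈-map⁻ _ (h i j))))))

      HasDeterminants⇒≤f : ∀ {d n} → HasDeterminants d n → n ℕ.≤ f d p A
      HasDeterminants⇒≤f {d} (Ms , over , distinct , n≤) = ℕP.≤-trans n≤
        (ℕP.≤-trans (ℕP.≤-reflexive (sym (length-map residue Ms)))
          (unique-⊆⇒length≤
            (AllPairsP.map⁺ (AllPairs.map (λ {M} {N} M≉N e → M≉N (%ℕ≡⇒≈ {a = det d M} {b = det d N} e)) distinct))
            λ r∈ → attained (∈-map⁻ residue r∈)))
        where
        residue : (Fin d → Fin d → ℤ) → ℕ
        residue M = det d M %ℕ p
        attained : ∀ {r} → ∃[ M ] M ∈ Ms × r ≡ residue M →
          r ∈ deduplicate ℕ._≟_ (map (detFp p d) (matricesOver d A))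
        attained (M , M∈ , refl) = ∈-deduplicate⁺ ℕ._≟_
          (subst (_∈ map (detFp p d) (matricesOver d A)) (detFp-reduction h)
            (∈-map⁺ (detFp p d) (reduction-∈ h)))
          where h = All.lookup over M∈

      HasDeterminants-border : ∀ {d n a b} → a ∈ values → b ∈ values → ¬ a ≈ b →
        HasDeterminants (suc d) n → HasDeterminants (suc (suc d)) n
      HasDeterminants-border {d} {n} {a} {b} a∈ b∈ a≉b (Ms , over , distinct , n≤) =
        map (border a b) Ms ,
        AllP.map⁺ (All.map border-over over) ,
        AllPairsP.map⁺ (AllPairs.map (λ {M} {N} M≉N h → M≉N (p∣-*-cancel (a - b) a≉b
          (p∣-resp (trans (cong₂ _-_ (det-border d a b M) (det-border d a b N))
                          (factor (a - b) (det (suc d) M) (det (suc d) N))) h))) distinct) ,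
        subst (n ℕ.≤_) (sym (length-map (border a b) Ms)) n≤
        where
        factor : ∀ c x y → c * x - c * y ≡ c * (x - y)
        factor = solve-∀
        border-over : ∀ {M} → Over M → Over (border a b M)
        border-over h zero    zero    = a∈
        border-over h zero    (suc j) = b∈
        border-over h (suc i) zero    = h i zero
        border-over h (suc i) (suc j) = h i j

      HasDeterminants-+ : ∀ e {d n a b} → a ∈ values → b ∈ values → ¬ a ≈ b →
        HasDeterminants (suc d) n → HasDeterminants (e ℕ.+ suc d) n
      HasDeterminants-+ zero    a∈ b∈ a≉b h = h
      HasDeterminants-+ (suc e) {d} {n} a∈ b∈ a≉b h =
        subst (λ k → HasDeterminants (suc k) n) (sym (ℕP.+-suc e d))
          (HasDeterminants-border a∈ b∈ a≉b
            (subst (λ k → HasDeterminants k n) (ℕP.+-suc e d) (HasDeterminants-+ e a∈ b∈ a≉b h)))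

      affine-determinants : ∀ {X : Set} {d} (g : X → ℤ) c c′ {S} → ¬ p∣ c →
        AllPairs (λ u v → ¬ g u ≈ g v) S →
        All (λ u → ∃[ M ] Over M × det d M ≡ c * g u + c′) S → HasDeterminants d (length S)
      affine-determinants {X} {d} g c c′ c# S# Ss with build S# Ss
        where
        AffineValue : List X → (Fin d → Fin d → ℤ) → Set
        AffineValue S M = ∃[ u ] u ∈ S × det d M ≡ c * g u + c′
        factor : ∀ c x y c′ → (c * x + c′) - (c * y + c′) ≡ c * (x - y)
        factor = solve-∀
        build : ∀ {S} → AllPairs (λ u v → ¬ g u ≈ g v) S →
          All (λ u → ∃[ M ] Over M × det d M ≡ c * g u + c′) S →
          ∃[ Ms ] All Over Ms × AllPairs (λ M N → ¬ det d M ≈ det d N) Ms ×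
            length Ms ≡ length S × All (AffineValue S) Ms
        build [] [] = [] , [] , [] , refl , []
        build {u ∷ S} (u# ∷ S#) ((M , over , e) ∷ Ss) with build S# Ss
        ... | Ms , overs , distinct , len , vals =
          M ∷ Ms , over ∷ overs ,
          All.map (λ {N} (v , v∈ , e′) h → All.lookup u# v∈ (p∣-*-cancel c c#
            (p∣-resp (trans (cong₂ _-_ e e′) (factor c (g u) (g v) c′)) h))) vals ∷ distinct ,
          cong suc len ,
          (u , here refl , e) ∷ All.map (λ (v , v∈ , e′) → v , there v∈ , e′) vals
      ... | Ms , over , distinct , len , _ = Ms , over , distinct , ℕP.≤-reflexive (sym len)

      one-determinant : ∀ d {a} → a ∈ values → HasDeterminants d 1
      one-determinant d {a} a∈ = (λ _ _ → a) ∷ [] , (λ _ _ → a∈) ∷ [] , [] ∷ [] , s≤s z≤n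

      -- Of two incongruent values one is nonzero. This makes e, and then e (e - g), a unit: the
      -- leading coefficients, up to sign, of the 3 by 3 and 5 by 5 determinants.
      unit-and-other : 2 ℕ.≤ length values → ∃[ e ] ∃[ g ] e ∈ values × g ∈ values × ¬ p∣ e × ¬ e ≈ g
      unit-and-other 2≤ with two-distinct values-distinct 2≤
      ... | y , z , y∈ , z∈ , y≉z with + p ∣? y
      ...   | no  p∤y = y , z , y∈ , z∈ , p∤y , y≉z
      ...   | yes p∣y = z , y , z∈ , y∈ , (λ p∣z → y≉z (∣m∣n⇒∣m-n p∣y p∣z)) , (λ h → y≉z (≈-sym {z} {y} h))

      -- Many 3 by 3 and 5 by 5 determinants.

      private N = length values

      over : ∀ {d} {V : Vec (Vec ℤ d) d} → VecAll.All (VecAll.All (_∈ values)) V → Over (entry V)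
      over h i j = lookup⁺ (lookup⁺ h i) j

      record LargeShear (L : List ℤ) : Set where
        field
          a a′ b b′ : ℤ
          a∈ : a ∈ values
          a′∈ : a′ ∈ values
          b∈ : b ∈ L
          b′∈ : b′ ∈ L
          S  : List Point
          S∈ : All (λ u → proj₁ u ∈ values × proj₂ u ∈ L) S
          S# : AllPairs (λ u v → ¬ sheared a a′ b b′ u ≈ sheared a a′ b b′ v) S
          -- Either all of `L` was used, or it was cut so that the product has at least p/2 points,
          -- whence 8 = 2 · 4.
          size : N ℕ.* length L ℕ.≤ 4 ℕ.* length S ⊎ p ℕ.≤ 8 ℕ.* length S

      abstract
        large-shear : ∀ L → Distinct L → 4 ℕ.≤ N → 2 ℕ.≤ length L → 2 ℕ.* N ℕ.≤ p → LargeShear L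
        large-shear L L# 4≤N 2≤L 2N≤p with budget {N} {p} {{ℕ.>-nonZero (ℕP.≤-trans (s≤s z≤n) 4≤N)}} (length L) 2N≤p
        ... | β , β≤ , Nβ≤p , large with two-distinct (AllPairsP.take⁺ β L#) (subst (2 ℕ.≤_) (sym |bs|) (2≤β large))
          where
          |bs| : length (take β L) ≡ β
          |bs| = trans (length-take β L) (ℕP.m≤n⇒m⊓n≡m β≤)
          2≤β : β ≡ length L ⊎ (2 ℕ.≤ β × p ℕ.≤ 2 ℕ.* (N ℕ.* β)) → 2 ℕ.≤ β
          2≤β (inj₁ e)       = subst (2 ℕ.≤_) (sym e) 2≤L
          2≤β (inj₂ (h , _)) = h
        ... | y , z , y∈ , z∈ , y≉z with rich-shear values (take β L) values-distinct (AllPairsP.take⁺ β L#) 4≤N y∈ z∈ y≉z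
               (subst (λ n → N ℕ.* n ℕ.≤ p) (sym (trans (length-take β L) (ℕP.m≤n⇒m⊓n≡m β≤))) Nβ≤p)
        ... | a , a′ , b , b′ , S , (a∈ , a′∈ , b∈ , b′∈) , S∈ , S# , Nβ≤ = record
          { a∈ = a∈ ; a′∈ = a′∈ ; b∈ = take-⊆ β L b∈ ; b′∈ = take-⊆ β L b′∈
          ; S∈ = All.map (λ u∈ → let x∈ , y∈ = ∈-cartesianProduct⁻ values (take β L) u∈ in x∈ , take-⊆ β L y∈) S∈
          ; S# = S# ; size = size large }
          where
          Nβ≤4S : N ℕ.* β ℕ.≤ 4 ℕ.* length S
          Nβ≤4S = subst (λ n → N ℕ.* n ℕ.≤ 4 ℕ.* length S) (trans (length-take β L) (ℕP.m≤n⇒m⊓n≡m β≤)) Nβ≤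
          size : β ≡ length L ⊎ (2 ℕ.≤ β × p ℕ.≤ 2 ℕ.* (N ℕ.* β)) →
            N ℕ.* length L ℕ.≤ 4 ℕ.* length S ⊎ p ℕ.≤ 8 ℕ.* length S
          size (inj₁ e)       = inj₁ (subst (λ n → N ℕ.* n ℕ.≤ 4 ℕ.* length S) e Nβ≤4S)
          size (inj₂ (_ , h)) = inj₂ (ℕP.≤-trans h (ℕP.≤-trans (ℕP.*-monoʳ-≤ 2 Nβ≤4S)
                                      (ℕP.≤-reflexive (sym (ℕP.*-assoc 2 4 (length S))))))

      determinants₃ : 4 ℕ.≤ N → 2 ℕ.* N ℕ.≤ p →
        ∃[ n ] HasDeterminants 3 n × (N ℕ.* N ℕ.≤ 4 ℕ.* n ⊎ p ℕ.≤ 8 ℕ.* n)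
      determinants₃ 4≤N 2N≤p = assemble (unit-and-other 2≤N)
        where
        2≤N : 2 ℕ.≤ N
        2≤N = ℕP.≤-trans (s≤s (s≤s z≤n)) 4≤N
        open LargeShear (large-shear values values-distinct 4≤N 2≤N 2N≤p)
        affine : ∀ x y e a a′ b b′ →
          e * ((b - b′) * x - (a - a′) * y) + e * (a * b′ - a′ * b)
            ≡ - e * ((a - a′) * y - (b - b′) * x) + e * (a * b′ - a′ * b)
        affine = solve-∀
        assemble : (∃[ e ] ∃[ g ] e ∈ values × g ∈ values × ¬ p∣ e × ¬ e ≈ g) →
          ∃[ n ] HasDeterminants 3 n × (N ℕ.* N ℕ.≤ 4 ℕ.* n ⊎ p ℕ.≤ 8 ℕ.* n)
        assemble (e , _ , e∈ , _ , p∤e , _) =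
          length S ,
          affine-determinants (sheared a a′ b b′) (- e) (e * (a * b′ - a′ * b))
            (λ h → p∤e (p∣-resp (ℤP.neg-involutive e) (∣m⇒∣-m h))) S#
            (All.map (λ {(x , y)} (x∈ , y∈) → entry (mat3 x y e a a′ b b′) ,
              over ((x∈ ∷ y∈ ∷ e∈ ∷ []) ∷ (a∈ ∷ b∈ ∷ e∈ ∷ []) ∷ (a′∈ ∷ b′∈ ∷ e∈ ∷ []) ∷ []) ,
              trans (det-mat3 x y e a a′ b b′) (affine x y e a a′ b b′)) S∈) ,
          size

      N²≤8* : ∀ {s} → N ℕ.* N ℕ.≤ p → N ℕ.* N ℕ.≤ 4 ℕ.* s ⊎ p ℕ.≤ 8 ℕ.* s → N ℕ.* N ℕ.≤ 8 ℕ.* s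
      N²≤8* {s} _ (inj₁ h) = ℕP.≤-trans h (ℕP.*-monoˡ-≤ s (ℕP.m≤m+n 4 4))
      N²≤8* N²≤p  (inj₂ h) = ℕP.≤-trans N²≤p h

      -- The second shear acts on pairs (z, v) with v = `inner` (x, y). Its parameters w and w′ are
      -- themselves values of `inner`, so they lift to points (s, t) and (s′, t′) with coordinates
      -- in `values`. In `mat5` the same a, a′, b, b′ produce both v and w - w′, so the determinant
      -- is affine in the second shear.
      determinants₅ : 4 ℕ.≤ N → N ℕ.* N ℕ.≤ p →
        ∃[ n ] HasDeterminants 5 n × (N ℕ.* (N ℕ.* N) ℕ.≤ 32 ℕ.* n ⊎ p ℕ.≤ 8 ℕ.* n)
      determinants₅ 4≤N N²≤p = assemble (unit-and-other 2≤N)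
        where
        2≤N : 2 ℕ.≤ N
        2≤N = ℕP.≤-trans (s≤s (s≤s z≤n)) 4≤N
        2N≤p : 2 ℕ.* N ℕ.≤ p
        2N≤p = ℕP.≤-trans (ℕP.*-monoˡ-≤ N 2≤N) N²≤p
        open LargeShear (large-shear values values-distinct 4≤N 2≤N 2N≤p)
        inner : Point → ℤ
        inner = sheared a a′ b b′
        -- In both cases of `size`, 16 ≤ N² ≤ 8 · length S.
        2≤S : 2 ℕ.≤ length (map inner S)
        2≤S = subst (2 ℕ.≤_) (sym (length-map inner S))
          (ℕP.*-cancelˡ-≤ 8 (ℕP.≤-trans (ℕP.*-mono-≤ 4≤N 4≤N) (N²≤8* {length S} N²≤p size)))
        open LargeShear (large-shear (map inner S) (AllPairsP.map⁺ S#) 4≤N 2≤S 2N≤p)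
          renaming (a to q; a′ to q′; b to w; b′ to w′; a∈ to q∈; a′∈ to q′∈; b∈ to w∈; b′∈ to w′∈;
                    S to T; S∈ to T∈; S# to T#; size to size′)
        total : N ℕ.* length (map inner S) ℕ.≤ 4 ℕ.* length T ⊎ p ℕ.≤ 8 ℕ.* length T →
          N ℕ.* (N ℕ.* N) ℕ.≤ 32 ℕ.* length T ⊎ p ℕ.≤ 8 ℕ.* length T
        total (inj₂ h) = inj₂ h
        total (inj₁ h) = inj₁ (begin
          N ℕ.* (N ℕ.* N)                    ≤⟨ ℕP.*-monoʳ-≤ N (N²≤8* {length S} N²≤p size) ⟩
          N ℕ.* (8 ℕ.* length S)             ≡⟨ ℕP.*-comm N _ ⟩
          8 ℕ.* length S ℕ.* N               ≡⟨ ℕP.*-assoc 8 (length S) N ⟩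
          8 ℕ.* (length S ℕ.* N)             ≡⟨ cong (8 ℕ.*_) (ℕP.*-comm (length S) N) ⟩
          8 ℕ.* (N ℕ.* length S)             ≡⟨ cong (λ n → 8 ℕ.* (N ℕ.* n)) (length-map inner S) ⟨
          8 ℕ.* (N ℕ.* length (map inner S)) ≤⟨ ℕP.*-monoʳ-≤ 8 h ⟩
          8 ℕ.* (4 ℕ.* length T)             ≡⟨ ℕP.*-assoc 8 4 (length T) ⟨
          32 ℕ.* length T                    ∎)
          where open ℕP.≤-Reasoning
        shear-difference : ∀ α β s s′ t t′ →
          α * (t - t′) - β * (s - s′) ≡ (α * t - β * s) - (α * t′ - β * s′)
        shear-difference = solve-∀
        affine : ∀ E x y z e a′ b′ α β δ ω →
          E * ((x - a′) * (β * δ) - (y - b′) * (α * δ) + (z - e) * ω)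
          ≡ - E * (δ * (α * y - β * x) - ω * z) + E * (δ * (b′ * α - a′ * β) - e * ω)
        affine = solve-∀
        Preimage : ℤ → Set
        Preimage v = ∃[ u ] u ∈ S × v ≡ inner u
        assemble : (∃[ e ] ∃[ g ] e ∈ values × g ∈ values × ¬ p∣ e × ¬ e ≈ g) →
          ∃[ n ] HasDeterminants 5 n × (N ℕ.* (N ℕ.* N) ℕ.≤ 32 ℕ.* n ⊎ p ℕ.≤ 8 ℕ.* n)
        assemble (e , g , e∈ , g∈ , p∤e , e≉g) = length T ,
          affine-determinants (sheared q q′ w w′) (- (e * (e - g))) constant p∤ T#
            (All.map (λ { (z∈ , v∈) → matrix z∈ (∈-map⁻ inner v∈) (∈-map⁻ inner w∈) (∈-map⁻ inner w′∈) }) T∈) ,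
          total size′
          where
          constant : ℤ
          constant = e * (e - g) * ((q - q′) * (b′ * (a - a′) - a′ * (b - b′)) - e * (w - w′))
          p∤ : ¬ p∣ (- (e * (e - g)))
          p∤ h = split (p∣-*-split e (e - g) (p∣-resp (ℤP.neg-involutive (e * (e - g))) (∣m⇒∣-m h)))
            where
            split : p∣ e ⊎ p∣ (e - g) → ⊥
            split (inj₁ k) = p∤e k
            split (inj₂ k) = e≉g k
          matrix : ∀ {z v} → z ∈ values → Preimage v → Preimage w → Preimage w′ →
            ∃[ M ] Over M × det 5 M ≡ - (e * (e - g)) * sheared q q′ w w′ (z , v) + constant
          matrix {z} z∈ ((x , y) , u∈ , refl) ((s , t) , st∈ , eq) ((s′ , t′) , st′∈ , eq′) =
            entry (mat5 x y z e g a a′ b b′ s s′ t t′ q q′) ,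
            over ((x∈ ∷ a∈ ∷ a′∈ ∷ s∈ ∷ s′∈ ∷ []) ∷
                  (y∈ ∷ b∈ ∷ b′∈ ∷ t∈ ∷ t′∈ ∷ []) ∷
                  (z∈ ∷ e∈ ∷ e∈ ∷ q∈ ∷ q′∈ ∷ []) ∷
                  (e∈ ∷ e∈ ∷ e∈ ∷ e∈ ∷ e∈ ∷ []) ∷
                  (e∈ ∷ e∈ ∷ e∈ ∷ g∈ ∷ g∈ ∷ []) ∷ []) ,
            trans (det-mat5 x y z e g a a′ b b′ s s′ t t′ q q′)
              (trans (cong (λ ω → e * (e - g) * ((x - a′) * ((b - b′) * (q - q′))
                                                  - (y - b′) * ((a - a′) * (q - q′)) + (z - e) * ω))
                       (trans (shear-difference (a - a′) (b - b′) s s′ t t′) (sym (cong₂ _-_ eq eq′))))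
                     (affine (e * (e - g)) x y z e a′ b′ (a - a′) (b - b′) (q - q′) (w - w′)))
            where
            x∈ = proj₁ (All.lookup S∈ u∈)
            y∈ = proj₂ (All.lookup S∈ u∈)
            s∈ = proj₁ (All.lookup S∈ st∈)
            t∈ = proj₂ (All.lookup S∈ st∈)
            s′∈ = proj₁ (All.lookup S∈ st′∈)
            t′∈ = proj₂ (All.lookup S∈ st′∈)

      -- From determinant families to the stated powers.

      f-positive : ∀ d → 1 ℕ.≤ N → 1 ℕ.≤ f d p A
      f-positive d 1≤N = HasDeterminants⇒≤f (one-determinant d (proj₂ (member values 1≤N)))
        where
        member : ∀ L → 1 ℕ.≤ length L → ∃[ a ] a ∈ L
        member (a ∷ _) _ = a , here refl

      small : ∀ {m} c d → 1 ℕ.≤ N → m ℕ.≤ c → m ℕ.≤ c ℕ.* f d p A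
      small c d 1≤N m≤c = ℕP.≤-trans m≤c (ℕP.m≤m*n c (f d p A) {{ℕ.>-nonZero (f-positive d 1≤N)}})

      -- The constant 9 covers the factors 4 and 8 from the shear, and also 3²: for at most three
      -- elements a single determinant is enough.
      f₃-bound : 1 ℕ.≤ N → N ℕ.^ 7 ℕ.≤ p ℕ.^ 4 → N ℕ.* N ℕ.≤ 9 ℕ.* f 3 p A ⊎ p ℕ.≤ 9 ℕ.* f 3 p A
      f₃-bound 1≤N h = by-size (ℕP.≤-<-connex N 3)
        where
        conclude : (∃[ n ] HasDeterminants 3 n × (N ℕ.* N ℕ.≤ 4 ℕ.* n ⊎ p ℕ.≤ 8 ℕ.* n)) →
          N ℕ.* N ℕ.≤ 9 ℕ.* f 3 p A ⊎ p ℕ.≤ 9 ℕ.* f 3 p A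
        conclude (n , H , inj₁ k) = inj₁ (ℕP.≤-trans k (ℕP.*-mono-≤ (ℕP.m≤m+n 4 5) (HasDeterminants⇒≤f H)))
        conclude (n , H , inj₂ k) = inj₂ (ℕP.≤-trans k (ℕP.*-mono-≤ (ℕP.m≤m+n 8 1) (HasDeterminants⇒≤f H)))
        by-size : N ℕ.≤ 3 ⊎ 4 ℕ.≤ N → N ℕ.* N ℕ.≤ 9 ℕ.* f 3 p A ⊎ p ℕ.≤ 9 ℕ.* f 3 p A
        by-size (inj₁ N≤3) = inj₁ (small 9 3 1≤N (ℕP.*-mono-≤ N≤3 N≤3))
        by-size (inj₂ 4≤N) = conclude (determinants₃ 4≤N (seventh-fourth-power⇒2*≤ 4≤N h))

      -- 32 = 8 · 4 comes from the two successive shears; it also exceeds 3³, which settles sets of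
      -- at most three elements.
      f₅₊-bound : ∀ e → 1 ℕ.≤ N → N ℕ.* N ℕ.≤ p →
        N ℕ.* (N ℕ.* N) ℕ.≤ 32 ℕ.* f (e ℕ.+ 5) p A ⊎ p ℕ.≤ 32 ℕ.* f (e ℕ.+ 5) p A
      f₅₊-bound e 1≤N N²≤p = by-size (ℕP.≤-<-connex N 3)
        where
        conclude : (∃[ a ] ∃[ b ] a ∈ values × b ∈ values × ¬ a ≈ b) →
          (∃[ n ] HasDeterminants 5 n × (N ℕ.* (N ℕ.* N) ℕ.≤ 32 ℕ.* n ⊎ p ℕ.≤ 8 ℕ.* n)) →
          N ℕ.* (N ℕ.* N) ℕ.≤ 32 ℕ.* f (e ℕ.+ 5) p A ⊎ p ℕ.≤ 32 ℕ.* f (e ℕ.+ 5) p A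
        conclude (a , b , a∈ , b∈ , a≉b) (n , H , bound) = choose bound
          where
          n≤f : n ℕ.≤ f (e ℕ.+ 5) p A
          n≤f = HasDeterminants⇒≤f (HasDeterminants-+ e a∈ b∈ a≉b H)
          choose : N ℕ.* (N ℕ.* N) ℕ.≤ 32 ℕ.* n ⊎ p ℕ.≤ 8 ℕ.* n →
            N ℕ.* (N ℕ.* N) ℕ.≤ 32 ℕ.* f (e ℕ.+ 5) p A ⊎ p ℕ.≤ 32 ℕ.* f (e ℕ.+ 5) p A
          choose (inj₁ k) = inj₁ (ℕP.≤-trans k (ℕP.*-monoʳ-≤ 32 n≤f))
          choose (inj₂ k) = inj₂ (ℕP.≤-trans k (ℕP.*-mono-≤ (ℕP.m≤m+n 8 24) n≤f))
        by-size : N ℕ.≤ 3 ⊎ 4 ℕ.≤ N →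
          N ℕ.* (N ℕ.* N) ℕ.≤ 32 ℕ.* f (e ℕ.+ 5) p A ⊎ p ℕ.≤ 32 ℕ.* f (e ℕ.+ 5) p A
        by-size (inj₁ N≤3) = inj₁ (small 32 (e ℕ.+ 5) 1≤N
          (ℕP.≤-trans (ℕP.*-mono-≤ N≤3 (ℕP.*-mono-≤ N≤3 N≤3)) (ℕP.m≤m+n 27 5)))
        by-size (inj₂ 4≤N) = conclude (two-distinct values-distinct (ℕP.≤-trans (s≤s (s≤s z≤n)) 4≤N))
          (determinants₅ 4≤N N²≤p)

      f₃-growth : N ℕ.^ 7 ℕ.≤ p ℕ.^ 4 → N ℕ.^ 7 ℕ.≤ 9 ℕ.^ 4 ℕ.* f 3 p A ℕ.^ 4
      f₃-growth h = by-size (ℕP.≤-<-connex N 0)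
        where
        by-size : N ℕ.≤ 0 ⊎ 1 ℕ.≤ N → N ℕ.^ 7 ℕ.≤ 9 ℕ.^ 4 ℕ.* f 3 p A ℕ.^ 4
        by-size (inj₁ N≤0) = ℕP.≤-trans (ℕP.^-monoˡ-≤ 7 N≤0) z≤n
        by-size (inj₂ 1≤N) = growth₃ {N} {p} {f 3 p A} 1≤N h (f₃-bound 1≤N h)

      f₅₊-growth : ∀ e {x} (4≤x : 4 ℕ.≤ x) → N ℕ.^ (136 ℕ.* x ℕ.∸ 137) ℕ.≤ p ℕ.^ (45 ℕ.* x) →
        N ℕ.^ (226 ℕ.* x ℕ.∸ 137) ℕ.≤ 32 ℕ.^ (90 ℕ.* x) ℕ.* f (e ℕ.+ 5) p A ℕ.^ (90 ℕ.* x)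
      f₅₊-growth e {x} 4≤x h = by-size (ℕP.≤-<-connex N 0)
        where
        open Exponents x 4≤x
        0^ : ∀ n → 0 ℕ.< n → 0 ℕ.^ n ≡ 0
        0^ (suc n) _ = refl
        -- For empty `A` the left side is 0 only because the exponent is positive.
        0<E : 0 ℕ.< E
        0<E = ℕP.m<n⇒0<n∸m (ℕP.≤-trans (ℕP.m≤m+n 138 766) (ℕP.*-monoʳ-≤ 226 4≤x))
        by-size : N ℕ.≤ 0 ⊎ 1 ℕ.≤ N →
          N ℕ.^ E ℕ.≤ 32 ℕ.^ (90 ℕ.* x) ℕ.* f (e ℕ.+ 5) p A ℕ.^ (90 ℕ.* x)
        by-size (inj₁ N≤0) = ℕP.≤-trans (ℕP.^-monoˡ-≤ E N≤0) (ℕP.≤-trans (ℕP.≤-reflexive (0^ E 0<E)) z≤n)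
        by-size (inj₂ 1≤N) = growth₅ {N} {p} {f (e ℕ.+ 5) p A} 1≤N h (f₅₊-bound e 1≤N (square≤ {N} {p} 1≤N h))

open import Defs
open import Data.Nat using (ℕ; _+_; _*_; _^_; _∸_; _≤_; NonZero; suc; zero; s≤s)
import Data.Nat.Properties as ℕP
open import Data.Nat.Primality using (Prime)
open import Data.Nat.Divisibility using (_∣_)
open import Data.Nat.Logarithm using (⌊log₂_⌋)
open import Data.Nat.Tactic.RingSolver using (solve-∀)
open import Data.Fin.Subset using (Subset; ∣_∣)
open import Data.List using (length)
open import Data.Product using (_×_; _,_; ∃-syntax)
open import Relation.Binary.PropositionalEquality using (_≡_; sym; subst; subst₂)
open import Relation.Nullary using (¬_)

theorem1p2 : (∃[ C ] ∀ (p : ℕ) .{{_ : NonZero p}} → Prime p → ¬ (2 ∣ p) → (A : Subset p) →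
    ∣ A ∣ ^ 7 ≤ p ^ 4 →
    ∣ A ∣ ^ 7 ≤ C * f 3 p A ^ 4)
    ×
    (∀ (k : ℕ) → 2 ≤ k →
    ∃[ C ] ∃[ c ] ∀ (p : ℕ) .{{_ : NonZero p}} → Prime p → ¬ (2 ∣ p) → (A : Subset p) →
    ∣ A ∣ ^ (136 * 2 ^ k ∸ 137) ≤ p ^ (45 * 2 ^ k) →
    ∣ A ∣ ^ (226 * 2 ^ k ∸ 137)
    ≤ C * (f (1 + 2 * k) p A * (1 + ⌊log₂ f (1 + 2 * k) p A ⌋) ^ c) ^ (90 * 2 ^ k))
-- The exponent 0 turns the logarithmic factor into 1.
theorem1p2 = (9 ^ 4 , cubic) , λ k 2≤k → 32 ^ (90 * 2 ^ k) , 0 , higher k 2≤k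
  where
  cubic : ∀ (p : ℕ) .{{_ : NonZero p}} → Prime p → ¬ (2 ∣ p) → (A : Subset p) →
    ∣ A ∣ ^ 7 ≤ p ^ 4 → ∣ A ∣ ^ 7 ≤ 9 ^ 4 * f 3 p A ^ 4
  cubic p pr _ A = subst (λ n → n ^ 7 ≤ p ^ 4 → n ^ 7 ≤ 9 ^ 4 * f 3 p A ^ 4)
    (sym (∣A∣≡length-values pr A)) (f₃-growth pr A)
    where open Determinants
  dimension : ∀ j → 2 * j + 5 ≡ 1 + 2 * suc (suc j)
  dimension = solve-∀
  -- With k = j + 2 the dimension is 2j + 5, so 5 by 5 matrices are bordered 2j times.
  higher : ∀ k → 2 ≤ k → ∀ (p : ℕ) .{{_ : NonZero p}} → Prime p → ¬ (2 ∣ p) → (A : Subset p) →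
    ∣ A ∣ ^ (136 * 2 ^ k ∸ 137) ≤ p ^ (45 * 2 ^ k) →
    ∣ A ∣ ^ (226 * 2 ^ k ∸ 137)
      ≤ 32 ^ (90 * 2 ^ k) * (f (1 + 2 * k) p A * 1) ^ (90 * 2 ^ k)
  higher k@(suc (suc j)) 2≤k p pr _ A = subst₂
    (λ n d → n ^ (136 * x ∸ 137) ≤ p ^ (45 * x) →
             n ^ (226 * x ∸ 137) ≤ 32 ^ (90 * x) * (f d p A * 1) ^ (90 * x))
    (sym (∣A∣≡length-values pr A)) (dimension j)
    (λ h → subst (λ F → length (values pr A) ^ (226 * x ∸ 137) ≤ 32 ^ (90 * x) * F ^ (90 * x))
             (sym (ℕP.*-identityʳ (f (2 * j + 5) p A)))
             (f₅₊-growth pr A (2 * j) (ℕP.^-monoʳ-≤ 2 2≤k) h))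
    where
    open Determinants
    x = 2 ^ k
  higher (suc zero) (s≤s ())
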